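{- For acyclic digraphs on $n$ vertices, the problem $k$-DMLOB can be solved in time $2^{O(k\log k)}\cdot n^{O(1)}$. That is, there exist an algorithm and an absolute constant $c$ such that, given any acyclic digraph $D$ on $n$ vertices and any positive integer $k$, the algorithm correctly decides whether $D$ has an out-branching with at least $k$ leaves, in time at most $c\cdot 2^{c k\log k}\cdot n^{c}$.
   Context: Digraphs are finite, with no loops and no parallel arcs. A digraph is acyclic if it has no directed cycle. A subdigraph $T$ of a digraph $D$ is an out-tree if $T$ is an oriented tree with only one vertex of in-degree zero (called the root); if moreover $V(T)=V(D)$, then $T$ is called an out-branching of $D$. The leaves of $T$ are its vertices of out-degree zero in $T$. The problem $k$-DMLOB (parameterized Directed Maximum Leaf Out-Branching) is: given a digraph $D$ and a positive integral parameter $k$, decide whether $D$ has an out-branching with at least $k$ leaves. -}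

module Defs where

open import Data.Bool.Base using (Bool; true; false; if_then_else_)
open import Data.Fin.Base using (Fin; toℕ; fromℕ<; combine; remQuot)
open import Data.Fin.Properties using (toℕ<n; toℕ-combine; fromℕ<-toℕ; fromℕ<-cong; remQuot-combine)
open import Data.Fin.Subset using (Subset; ∣_∣)
open import Data.List.Base using (List; _∷_; _∷ʳ_; length)
open import Data.List.Relation.Unary.Linked using (Linked)
open import Data.List.Relation.Unary.Unique.Propositional using (Unique)
open import Data.Nat.Base using (ℕ; _+_; _*_; _∸_; _≤_; _<_)
open import Data.Nat.Properties using (_≟_; _<?_)
open import Data.Product using (_×_; _,_; ∃-syntax; ∃!; uncurry)
open import Data.Sum.Base using (_⊎_)
open import Data.Vec.Base using (tabulate)
open import Level using (0ℓ)
open import Relation.Binary.Core using (Rel)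
open import Relation.Binary.Construct.Closure.Equivalence using (EqClosure)
open import Relation.Binary.Construct.Closure.Symmetric using (SymClosure)
open import Relation.Binary.PropositionalEquality using (_≡_; _≢_; refl; sym; cong; subst; module ≡-Reasoning)
open import Relation.Nullary using (¬_; yes; no; does; contradiction)

------------------------------------------------------------------------
-- Digraphs

-- Opposite arcs uv and vu may both be present: they are not parallel.
record Digraph (n : ℕ) : Set where
  field
    arc     : Fin n → Fin n → Bool
    no-loop : ∀ v → arc v v ≡ false

  Arc : Rel (Fin n) 0ℓ
  Arc u v = arc u v ≡ true

  Edge : Rel (Fin n) 0ℓ
  Edge = SymClosure Arc

  indegree : Fin n → ℕ
  indegree v = ∣ tabulate (λ u → arc u v) ∣

  outdegree : Fin n → ℕ
  outdegree u = ∣ tabulate (λ v → arc u v) ∣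

  leaves : Subset n
  leaves = tabulate λ v → does (outdegree v ≟ 0)

open Digraph public

-- The cycle v → v₁ → … → vₘ → v through distinct vertices v, v₁, …, vₘ,
-- where vs = v₁ ∷ … ∷ vₘ ∷ [].
IsCycle : ∀ {n} → Rel (Fin n) 0ℓ → Fin n → List (Fin n) → Set
IsCycle R v vs = Unique (v ∷ vs) × Linked R (v ∷ (vs ∷ʳ v))

Acyclic : ∀ {n} → Digraph n → Set
Acyclic D = ∀ v vs → ¬ IsCycle (Arc D) v vs

-- An orientation of a tree: no two opposite arcs, and the underlying
-- undirected graph is connected and has no cycle.  An undirected cycle has
-- at least three vertices.
record IsOrientedTree {n} (T : Digraph n) : Set where
  field
    oriented  : ∀ u v → Arc T u v → ¬ Arc T v u
    connected : ∀ u v → EqClosure (Arc T) u v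
    no-cycle  : ∀ v vs → 2 ≤ length vs → ¬ IsCycle (Edge T) v vs

record IsOutTree {n} (T : Digraph n) : Set where
  field
    tree : IsOrientedTree T
    root : ∃! _≡_ λ r → indegree T r ≡ 0

-- Since V(T) = V(D), T is given as a digraph on the same vertices.
record IsOutBranching {n} (D T : Digraph n) : Set where
  field
    subdigraph : ∀ u v → Arc T u v → Arc D u v
    out-tree   : IsOutTree T

DMLOB : ∀ {n} → Digraph n → ℕ → Set
DMLOB D k = ∃[ T ] IsOutBranching D T × k ≤ ∣ leaves T ∣

------------------------------------------------------------------------
-- Model of computation: a random access machine programmed by structured
-- code.  Memory consists of registers and arrays of natural numbers, and a
-- program mentions only finitely many of them.  Cost is uniform.  Addition
-- and truncated subtraction are the only arithmetic operations, so that
-- numbers get at most one bit longer per step and the machine is polynomially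
-- equivalent to a Turing machine (with unit-cost multiplication it might not
-- be).

infix  8 _[_]
infixl 6 _⊕_ _⊖_
infix  4 _≔_ _[_]≔_
infixr 3 _⨾_

data Exp : Set where
  lit     : ℕ → Exp
  var     : ℕ → Exp
  _[_]    : ℕ → Exp → Exp
  _⊕_ _⊖_ : Exp → Exp → Exp

-- A condition holds when its value is nonzero.
data Program : Set where
  skip    : Program
  _≔_     : ℕ → Exp → Program
  _[_]≔_  : ℕ → Exp → Exp → Program
  _⨾_     : Program → Program → Program
  ifnz    : Exp → Program → Program → Program
  whilenz : Exp → Program → Program

record State : Set where
  constructor ⟨_,_⟩
  field
    register : ℕ → ℕ
    array    : ℕ → ℕ → ℕ

open State public

_[_↦_] : {A : Set} → (ℕ → A) → ℕ → A → (ℕ → A)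
(f [ x ↦ a ]) y = if does (y ≟ x) then a else f y

setRegister : ℕ → ℕ → State → State
setRegister x m ⟨ ρ , μ ⟩ = ⟨ ρ [ x ↦ m ] , μ ⟩

setArray : ℕ → ℕ → ℕ → State → State
setArray a i m ⟨ ρ , μ ⟩ = ⟨ ρ , μ [ a ↦ μ a [ i ↦ m ] ] ⟩

⟦_⟧ : Exp → State → ℕ
⟦ lit m   ⟧ s = m
⟦ var x   ⟧ s = register s x
⟦ a [ e ] ⟧ s = array s a (⟦ e ⟧ s)
⟦ e ⊕ f   ⟧ s = ⟦ e ⟧ s + ⟦ f ⟧ s
⟦ e ⊖ f   ⟧ s = ⟦ e ⟧ s ∸ ⟦ f ⟧ s

cost : Exp → ℕ
cost (lit m)   = 1
cost (var x)   = 1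
cost (a [ e ]) = 1 + cost e
cost (e ⊕ f)   = 1 + cost e + cost f
cost (e ⊖ f)   = 1 + cost e + cost f

-- p , s ⇓ s′ , t : started in state s, the program p halts in state s′ after
-- time t.
infix 2 _,_⇓_,_

data _,_⇓_,_ : Program → State → State → ℕ → Set where
  skip : ∀ {s} →
         skip , s ⇓ s , 1

  assign : ∀ {x e s} →
           x ≔ e , s ⇓ setRegister x (⟦ e ⟧ s) s , 1 + cost e

  store : ∀ {a e f s} →
          a [ e ]≔ f , s ⇓ setArray a (⟦ e ⟧ s) (⟦ f ⟧ s) s , 1 + cost e + cost f

  seq : ∀ {p q s s′ s″ t t′} →
        p , s ⇓ s′ , t →
        q , s′ ⇓ s″ , t′ →
        p ⨾ q , s ⇓ s″ , t + t′

  if-nonzero : ∀ {e p q s s′ t} →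
               ⟦ e ⟧ s ≢ 0 →
               p , s ⇓ s′ , t →
               ifnz e p q , s ⇓ s′ , 1 + cost e + t

  if-zero : ∀ {e p q s s′ t} →
            ⟦ e ⟧ s ≡ 0 →
            q , s ⇓ s′ , t →
            ifnz e p q , s ⇓ s′ , 1 + cost e + t

  while-nonzero : ∀ {e p s s′ s″ t t′} →
                  ⟦ e ⟧ s ≢ 0 →
                  p , s ⇓ s′ , t →
                  whilenz e p , s′ ⇓ s″ , t′ →
                  whilenz e p , s ⇓ s″ , 1 + cost e + t + t′

  while-zero : ∀ {e p s} →
               ⟦ e ⟧ s ≡ 0 →
               whilenz e p , s ⇓ s , 1 + cost e

⇓-deterministic : ∀ {p s s₁ s₂ t₁ t₂} →
                  p , s ⇓ s₁ , t₁ → p , s ⇓ s₂ , t₂ → s₁ ≡ s₂ × t₁ ≡ t₂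
⇓-deterministic skip skip = refl , refl
⇓-deterministic assign assign = refl , refl
⇓-deterministic store store = refl , refl
⇓-deterministic (seq d₁ d₂) (seq d₁′ d₂′)
  with refl , refl ← ⇓-deterministic d₁ d₁′
  with refl , refl ← ⇓-deterministic d₂ d₂′ = refl , refl
⇓-deterministic (if-nonzero _ d) (if-nonzero _ d′)
  with refl , refl ← ⇓-deterministic d d′ = refl , refl
⇓-deterministic (if-nonzero ≢0 _) (if-zero ≡0 _) = contradiction ≡0 ≢0
⇓-deterministic (if-zero ≡0 _) (if-nonzero ≢0 _) = contradiction ≡0 ≢0
⇓-deterministic (if-zero _ d) (if-zero _ d′)
  with refl , refl ← ⇓-deterministic d d′ = refl , refl
⇓-deterministic (while-nonzero _ d₁ d₂) (while-nonzero _ d₁′ d₂′)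
  with refl , refl ← ⇓-deterministic d₁ d₁′
  with refl , refl ← ⇓-deterministic d₂ d₂′ = refl , refl
⇓-deterministic (while-nonzero ≢0 _ _) (while-zero ≡0) = contradiction ≡0 ≢0
⇓-deterministic (while-zero ≡0) (while-nonzero ≢0 _ _) = contradiction ≡0 ≢0
⇓-deterministic (while-zero _) (while-zero _) = refl , refl

------------------------------------------------------------------------
-- Input and output

-- The n × n adjacency matrix of D, row by row, followed by zeros.
matrix : ∀ {n} → Digraph n → ℕ → ℕ
matrix {n} D m with m <? n * n
... | yes m<n² = if uncurry (arc D) (remQuot n (fromℕ< m<n²)) then 1 else 0
... | no  _    = 0

matrix-entry : ∀ {n} (D : Digraph n) (i j : Fin n) →
               matrix D (n * toℕ i + toℕ j) ≡ (if arc D i j then 1 else 0)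
matrix-entry {n} D i j with n * toℕ i + toℕ j <? n * n
... | yes p = cong (λ ij → if uncurry (arc D) ij then 1 else 0) (begin
    remQuot n (fromℕ< p)
      ≡⟨ cong (remQuot n) (fromℕ<-cong _ _ (sym (toℕ-combine i j)) p (toℕ<n (combine i j))) ⟩
    remQuot n (fromℕ< (toℕ<n (combine i j)))
      ≡⟨ cong (remQuot n) (fromℕ<-toℕ (combine i j) (toℕ<n (combine i j))) ⟩
    remQuot n (combine i j)
      ≡⟨ remQuot-combine i j ⟩
    (i , j) ∎)
  where open ≡-Reasoning
... | no ¬p = contradiction (subst (_< n * n) (toℕ-combine i j) (toℕ<n (combine i j))) ¬p

-- Register 0 holds n, register 1 holds k and array 0 holds the adjacency
-- matrix; the rest of the memory is zero.
input : ∀ {n} → Digraph n → ℕ → State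
input {n} D k = ⟨ registers , arrays ⟩
  where
  registers : ℕ → ℕ
  registers 0 = n
  registers 1 = k
  registers _ = 0

  arrays : ℕ → ℕ → ℕ
  arrays 0 = matrix D
  arrays _ = λ _ → 0

-- p, started in state s, halts within time b, and the answer it leaves in
-- register 0 (1 for yes, 0 for no) is correct for the question P.
Decides_From_Within_By_ : Set → State → ℕ → Program → Set
Decides P From s Within b By p =
  ∃[ s′ ] ∃[ t ] (p , s ⇓ s′ , t) × t ≤ b ×
    ((P × register s′ 0 ≡ 1) ⊎ (¬ P × register s′ 0 ≡ 0))

{-# OPTIONS --safe #-}

-- In an acyclic digraph every choice of one parent for each vertex but the only
-- source is an out-branching, so k leaves are possible iff there is just one
-- source and some set L of k vertices contains the in-neighbourhood of no other
-- vertex.  Such an L avoids the only parent of every vertex of indegree 1; call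
-- these parents forced and let N be the number of the other vertices.
--
-- There are at most as many forced vertices as vertices of indegree 1, so the
-- vertices of indegree at least 2 are fewer than N, and each of them either has
-- a forced parent or gives an edge joining two unforced parents.  A graph
-- with N vertices and at most N edges has a vertex cover of size at most 2N/3,
-- whose complement is a valid L; so the answer is yes if N ≥ 3k.  Otherwise
-- the 2^N < 2^(3k) sets of unforced vertices are tried one by one.
module Submission where

open import Defs
open import Data.Bool.Base using (Bool; true; false; _∨_; if_then_else_)
import Data.Bool.Properties as Bool
open import Data.Empty using (⊥)
open import Data.Fin.Base as Fin using (Fin; toℕ; fromℕ<; remQuot)
open import Data.Fin.Properties as Fin using (toℕ<n; toℕ-fromℕ<; fromℕ<-toℕ; toℕ-injective; injective⇒≤; any?)
open import Data.Fin.Subset using (∣_∣)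
open import Data.List.Base using (List; []; _∷_; _∷ʳ_; length; lookup; filter; downFrom)
open import Data.List.Membership.DecPropositional using (_∈?_)
open import Data.List.Membership.Propositional using (_∈_; lose)
open import Data.List.Membership.Propositional.Properties using (∈-filter⁺; ∈-filter⁻; ∈-downFrom⁺; ∈-lookup)
open import Data.List.Properties using (filter-notAll; length-filter)
open import Data.List.Relation.Unary.All as All using (All; []; _∷_)
open import Data.List.Relation.Unary.AllPairs using ([]; _∷_)
open import Data.List.Relation.Unary.Any as Any using (Any; here; there)
open import Data.List.Relation.Unary.Linked using (Linked; [-]; _∷_)
open import Data.List.Relation.Unary.Unique.Propositional using (Unique)
open import Data.Nat.Base
open import Data.Nat.Properties
open import Data.Nat.Tactic.RingSolver using (solve-∀)
open import Data.Product using (_×_; _,_; ∃-syntax; proj₁; proj₂; uncurry)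
open import Data.Sum.Base as Sum using (_⊎_; inj₁; inj₂)
open import Data.Vec.Base using (tabulate)
open import Function.Base using (id; _∘_)
open import Induction.WellFounded using (WellFounded; Acc; acc; wf⇒irrefl)
open import Level using (0ℓ)
open import Relation.Binary.Construct.Closure.Equivalence as Equivalence using (EqClosure)
open import Relation.Binary.Construct.Closure.ReflexiveTransitive using (ε; _◅_)
open import Relation.Binary.Construct.Closure.Symmetric using (fwd; bwd)
open import Relation.Binary.Construct.Closure.Transitive as Plus using (TransClosure; _∷_)
open import Relation.Binary.Core using (Rel)
open import Relation.Binary.Definitions using (tri<; tri≈; tri>)
open import Relation.Binary.PropositionalEquality hiding ([_])
open import Relation.Nullary using (¬_; yes; no; does; contradiction; Dec; ¬?)
open import Relation.Nullary.Decidable using (_⊎-dec_; dec-true; dec-false)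

-- All quantities that settle the question (indegrees, forcedness, uncovered vertices) are iterated
-- sums of expressions in truncated subtraction. The machine evaluates the same expressions, so one
-- loop lemma for sums verifies all of the counting. Since the machine cannot multiply, row offsets
-- of the matrix are repeated additions, powers of two are doublings, and a mask is decoded by
-- subtracting weights from the top.
--
-- The enumeration needs no bijection between masks and sets. A decoded set that passes the check is
-- good whatever the mask was, and every good set is met because its own code is decoded correctly.
--
-- The exponent obtained is linear in `k`, while the bound to be met is `k ^ (c * k)`. For `k ≥ 2`
-- that bound is weaker, but at `k = 1` the power is 1, so a factor `2 ^ 3` has to go into the
-- constant.

-- Finite sums

∑ : ℕ → (ℕ → ℕ) → ℕ
∑ zero    f = 0
∑ (suc n) f = ∑ n f + f n

∑-cong : ∀ n {f g} → (∀ i → i < n → f i ≡ g i) → ∑ n f ≡ ∑ n g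
∑-cong zero    f≡g = refl
∑-cong (suc n) f≡g = cong₂ _+_ (∑-cong n λ i i<n → f≡g i (m<n⇒m<1+n i<n)) (f≡g n ≤-refl)

∑-mono : ∀ n {f g} → (∀ i → i < n → f i ≤ g i) → ∑ n f ≤ ∑ n g
∑-mono zero    f≤g = ≤-refl
∑-mono (suc n) f≤g = +-mono-≤ (∑-mono n λ i i<n → f≤g i (m<n⇒m<1+n i<n)) (f≤g n ≤-refl)

∑-+ : ∀ n f g → ∑ n (λ i → f i + g i) ≡ ∑ n f + ∑ n g
∑-+ zero    f g = refl
∑-+ (suc n) f g rewrite ∑-+ n f g = interchange (∑ n f) (∑ n g) (f n) (g n)
  where
  interchange : ∀ a b c d → a + b + (c + d) ≡ a + c + (b + d)
  interchange = solve-∀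

∑-const : ∀ n c → ∑ n (λ _ → c) ≡ n * c
∑-const zero    c = refl
∑-const (suc n) c = trans (cong (_+ c) (∑-const n c)) (+-comm (n * c) c)

∑-zero : ∀ n {f} → (∀ i → i < n → f i ≡ 0) → ∑ n f ≡ 0
∑-zero n f≡0 = trans (∑-cong n f≡0) (trans (∑-const n 0) (*-zeroʳ n))

∑-swap : ∀ m n (f : ℕ → ℕ → ℕ) → ∑ m (λ i → ∑ n (f i)) ≡ ∑ n (λ j → ∑ m (λ i → f i j))
∑-swap zero    n f = sym (∑-zero n λ _ _ → refl)
∑-swap (suc m) n f = trans (cong (_+ ∑ n (f m)) (∑-swap m n f)) (sym (∑-+ n (λ j → ∑ m (λ i → f i j)) (f m)))

∑-first : ∀ n f → ∑ (suc n) f ≡ f 0 + ∑ n (f ∘ suc)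
∑-first zero    f = +-comm 0 (f 0)
∑-first (suc n) f = trans (cong (_+ f (suc n)) (∑-first n f)) (+-assoc (f 0) _ _)

term≤∑ : ∀ n f {i} → i < n → f i ≤ ∑ n f
term≤∑ (suc n) f i<1+n with m<1+n⇒m<n∨m≡n i<1+n
... | inj₁ i<n  = ≤-trans (term≤∑ n f i<n) (m≤m+n _ (f n))
... | inj₂ refl = m≤n+m (f n) _

two-terms≤∑ : ∀ n f {i j} → i < j → j < n → f i + f j ≤ ∑ n f
two-terms≤∑ (suc n) f i<j j<1+n with m<1+n⇒m<n∨m≡n j<1+n
... | inj₁ j<n  = ≤-trans (two-terms≤∑ n f i<j j<n) (m≤m+n _ (f n))
... | inj₂ refl = +-monoˡ-≤ (f n) (term≤∑ n f i<j)

∑≤1⇒unique : ∀ n f {i j} → ∑ n f ≤ 1 → i < n → j < n → f i ≢ 0 → f j ≢ 0 → i ≡ j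
∑≤1⇒unique n f {i} {j} ∑≤1 i<n j<n fi≢0 fj≢0 with <-cmp i j
... | tri≈ _ i≡j _ = i≡j
... | tri< i<j _ _ = contradiction (≤-trans (+-mono-≤ (n≢0⇒n>0 fi≢0) (n≢0⇒n>0 fj≢0))
                       (≤-trans (two-terms≤∑ n f i<j j<n) ∑≤1)) λ { (s≤s ()) }
... | tri> _ _ j<i = contradiction (≤-trans (+-mono-≤ (n≢0⇒n>0 fj≢0) (n≢0⇒n>0 fi≢0))
                       (≤-trans (two-terms≤∑ n f j<i i<n) ∑≤1)) λ { (s≤s ()) }

∑≢0⇒∃ : ∀ n f → ∑ n f ≢ 0 → ∃[ i ] i < n × f i ≢ 0
∑≢0⇒∃ zero    f ∑≢0 = contradiction refl ∑≢0
∑≢0⇒∃ (suc n) f ∑≢0 with f n ≟ 0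
... | no fn≢0 = n , ≤-refl , fn≢0
... | yes fn≡0 with i , i<n , fi≢0 ← ∑≢0⇒∃ n f (λ ∑≡0 → ∑≢0 (cong₂ _+_ ∑≡0 fn≡0)) =
  i , m<n⇒m<1+n i<n , fi≢0

unique⇒∑≤1 : ∀ n f r → (∀ i → i < n → f i ≤ 1) → (∀ i → i < n → f i ≢ 0 → i ≡ r) → ∑ n f ≤ 1
unique⇒∑≤1 zero    f r f≤1 supp = z≤n
unique⇒∑≤1 (suc n) f r f≤1 supp with f n ≟ 0
... | yes fn≡0 rewrite fn≡0 | +-identityʳ (∑ n f) =
  unique⇒∑≤1 n f r (λ i i<n → f≤1 i (m<n⇒m<1+n i<n)) (λ i i<n → supp i (m<n⇒m<1+n i<n))
... | no fn≢0 = subst (λ z → z + f n ≤ 1) (sym (∑-zero n vanish)) (f≤1 n ≤-refl)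
  where
  vanish : ∀ i → i < n → f i ≡ 0
  vanish i i<n with f i ≟ 0
  ... | yes fi≡0 = fi≡0
  ... | no fi≢0 = contradiction (trans (supp i (m<n⇒m<1+n i<n) fi≢0) (sym (supp n ≤-refl fn≢0))) (<⇒≢ i<n)

2≤∑⇒∃₂ : ∀ n f → (∀ i → i < n → f i ≤ 1) → 2 ≤ ∑ n f →
         ∃[ i ] ∃[ j ] i < n × j < n × i ≢ j × f i ≢ 0 × f j ≢ 0
2≤∑⇒∃₂ (suc n) f f≤1 2≤∑ with f n ≟ 0
... | yes fn≡0 with i , j , i<n , j<n , rest ← 2≤∑⇒∃₂ n f (λ i i<n → f≤1 i (m<n⇒m<1+n i<n))
                     (subst (2 ≤_) (trans (cong (∑ n f +_) fn≡0) (+-identityʳ _)) 2≤∑) =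
  i , j , m<n⇒m<1+n i<n , m<n⇒m<1+n j<n , rest
... | no fn≢0 with i , i<n , fi≢0 ← ∑≢0⇒∃ n f (λ ∑≡0 → <⇒≱ (≤-trans 2≤∑ (≤-reflexive (cong (_+ f n) ∑≡0))) (f≤1 n ≤-refl)) =
  i , n , m<n⇒m<1+n i<n , ≤-refl , <⇒≢ i<n , fi≢0 , fn≢0

-- Hitting sets of graphs

Touches : ℕ → ℕ × ℕ → Set
Touches v (a , b) = v ≡ a ⊎ v ≡ b

touches? : ∀ v e → Dec (Touches v e)
touches? v (a , b) = v ≟ a ⊎-dec v ≟ b

Hits : List ℕ → ℕ × ℕ → Set
Hits H (a , b) = a ∈ H ⊎ b ∈ H

EdgeIn : List ℕ → ℕ × ℕ → Set
EdgeIn S (a , b) = a ≢ b × a ∈ S × b ∈ S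

_∖_ : List ℕ → ℕ → List ℕ
S ∖ v = filter (λ u → ¬? (v ≟ u)) S

avoiding : ℕ → List (ℕ × ℕ) → List (ℕ × ℕ)
avoiding v = filter (λ e → ¬? (touches? v e))

length-∖ : ∀ {S v} → v ∈ S → length (S ∖ v) < length S
length-∖ {S} v∈S = filter-notAll _ S (Any.map (λ v≡u v≢u → v≢u v≡u) v∈S)

length-avoiding : ∀ {E v} → Any (Touches v) E → length (avoiding v E) < length E
length-avoiding {E} any = filter-notAll _ E (Any.map (λ t ¬t → ¬t t) any)

EdgeIn-∖ : ∀ {S v e} → ¬ Touches v e → EdgeIn S e → EdgeIn (S ∖ v) e
EdgeIn-∖ ¬t (a≢b , a∈S , b∈S) =
  a≢b , ∈-filter⁺ _ a∈S (¬t ∘ inj₁) , ∈-filter⁺ _ b∈S (¬t ∘ inj₂)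

Hits-∷ : ∀ {H v e} → Hits H e → Hits (v ∷ H) e
Hits-∷ (inj₁ a∈H) = inj₁ (there a∈H)
Hits-∷ (inj₂ b∈H) = inj₂ (there b∈H)

Touches⇒Hits : ∀ {H v e} → Touches v e → Hits (v ∷ H) e
Touches⇒Hits (inj₁ refl) = inj₁ (here refl)
Touches⇒Hits (inj₂ refl) = inj₂ (here refl)

-- Three units per vertex of `H` are what a greedy choice can pay for. With N vertices and at most N
-- edges this becomes the bound 2N/3; keeping both counts in one sum lets a step pay in vertices, in
-- edges or in a mixture.
HittingSet : List ℕ → List (ℕ × ℕ) → Set
HittingSet S E = ∃[ H ] 3 * length H ≤ length S + length E × (∀ {e} → e ∈ E → Hits H e)

private
  add-vertex : ∀ {h x y} → 3 * h ≤ x → 3 + x ≤ y → 3 * suc h ≤ y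
  add-vertex {h} 3h≤x 3+x≤y = ≤-trans (≤-reflexive (*-suc 3 h)) (≤-trans (+-monoʳ-≤ 3 3h≤x) 3+x≤y)

-- Greedy: an endpoint of the first edge that lies on another edge hits two
-- edges at the price of one vertex; if there is none, then both endpoints
-- disappear with the edge.
hitting-set : ∀ fuel S E → length E ≤ fuel → All (EdgeIn S) E → HittingSet S E

hit-twice : ∀ fuel S E → length E ≤ fuel → All (EdgeIn S) E →
            ∀ {e v} → v ∈ S → Touches v e → Any (Touches v) E → HittingSet S (e ∷ E)

hitting-set fuel S [] _ _ = [] , z≤n , λ ()
hitting-set (suc fuel) S ((a , b) ∷ E) (s≤s |E|≤) ((a≢b , a∈S , b∈S) ∷ E⊆S)
  with Any.any? (touches? a) E | Any.any? (touches? b) E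
... | yes t | _     = hit-twice fuel S E |E|≤ E⊆S a∈S (inj₁ refl) t
... | no _  | yes t = hit-twice fuel S E |E|≤ E⊆S b∈S (inj₂ refl) t
... | no ¬a | no ¬b
  with H , 3H≤ , hits ← hitting-set fuel ((S ∖ a) ∖ b) E |E|≤ (All.tabulate λ e∈E →
         EdgeIn-∖ (λ t → ¬b (lose e∈E t)) (EdgeIn-∖ (λ t → ¬a (lose e∈E t)) (All.lookup E⊆S e∈E)))
  = a ∷ H , add-vertex 3H≤ bound , λ { (here refl) → Touches⇒Hits (inj₁ refl) ; (there e∈E) → Hits-∷ (hits e∈E) }
  where
  bound : 3 + (length ((S ∖ a) ∖ b) + length E) ≤ length S + suc (length E)
  bound = ≤-trans (≤-reflexive (rearrange (length ((S ∖ a) ∖ b)) (length E)))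
    (+-monoˡ-≤ (suc (length E)) (≤-trans (s≤s (length-∖ {v = b} (∈-filter⁺ _ b∈S a≢b))) (length-∖ a∈S)))
    where
    rearrange : ∀ s m → 3 + (s + m) ≡ 2 + s + suc m
    rearrange = solve-∀

hit-twice fuel S E |E|≤ E⊆S {e} {v} v∈S t ts
  with H , 3H≤ , hits ← hitting-set fuel (S ∖ v) (avoiding v E)
         (≤-trans (length-filter _ E) |E|≤)
         (All.tabulate λ e∈ → let e∈E , ¬t = ∈-filter⁻ _ e∈ in EdgeIn-∖ ¬t (All.lookup E⊆S e∈E))
  = v ∷ H , add-vertex 3H≤ bound , hits′
  where
  bound : 3 + (length (S ∖ v) + length (avoiding v E)) ≤ length S + suc (length E)
  bound = ≤-trans (≤-reflexive (rearrange (length (S ∖ v)) (length (avoiding v E))))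
    (+-mono-≤ (length-∖ v∈S) (s≤s (length-avoiding ts)))
    where
    rearrange : ∀ s m → 3 + (s + m) ≡ suc s + (2 + m)
    rearrange = solve-∀
  hits′ : ∀ {e′} → e′ ∈ e ∷ E → Hits (v ∷ H) e′
  hits′ (here refl) = Touches⇒Hits t
  hits′ {e′} (there e∈E) with touches? v e′
  ... | yes te = Touches⇒Hits te
  ... | no ¬te = Hits-∷ (hits (∈-filter⁺ _ e∈E ¬te))

-- Leaf sets in terms of a 0-1 matrix

1∸≢0 : ∀ {x} → 1 ∸ x ≢ 0 → x ≡ 0
1∸≢0 {zero}  _  = refl
1∸≢0 {suc x} ≢0 = contradiction (0∸n≡0 x) ≢0

1∸0≢0 : ∀ {x} → x ≡ 0 → 1 ∸ x ≢ 0
1∸0≢0 refl ()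

1∸≡0 : ∀ {x} → 1 ∸ x ≡ 0 → x ≢ 0
1∸≡0 1≡0 refl = contradiction 1≡0 λ ()

≢0⇒1∸≡0 : ∀ {x} → x ≢ 0 → 1 ∸ x ≡ 0
≢0⇒1∸≡0 x≢0 = m≤n⇒m∸n≡0 (n≢0⇒n>0 x≢0)

1∸≤1 : ∀ x → 1 ∸ x ≤ 1
1∸≤1 x = m∸n≤m 1 x

-- Truncated subtraction serves as logic: 1 ∸ x is the indicator of x = 0, hence
-- the negation of x if x ≤ 1.
module LeafSets (n : ℕ) (A : ℕ → ℕ → ℕ) (A≤1 : ∀ u v → A u v ≤ 1) where

  deg : ℕ → ℕ
  deg w = ∑ n (λ u → A u w)

  -- A sum inside `1 ∸` acts as a conjunction: the three summands vanish exactly if `deg w ≤ 1`,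
  -- `1 ≤ deg w` and `A u w ≢ 0`.
  onlyParent : ℕ → ℕ → ℕ
  onlyParent u w = 1 ∸ (deg w ∸ 1 + (1 ∸ deg w) + (1 ∸ A u w))

  forced : ℕ → ℕ
  forced u = ∑ n (onlyParent u)

  sources : ℕ
  sources = ∑ n (λ w → 1 ∸ deg w)

  candidates : ℕ
  candidates = ∑ n (λ v → 1 ∸ forced v)

  -- The number of in-neighbours of `w` outside `L`, which are the vertices still available as a
  -- parent of `w` when those of `L` are to be leaves.
  cover : (ℕ → ℕ) → ℕ → ℕ
  cover L w = ∑ n (λ u → 1 ∸ (1 ∸ A u w + L u))

  uncovered : (ℕ → ℕ) → ℕ
  uncovered L = ∑ n (λ w → 1 ∸ cover L w)

  -- The bound on `uncovered` is 1 rather than 0 because a source has no in-neighbour and stays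
  -- uncovered whatever `L` is.
  record Good (k : ℕ) (L : ℕ → ℕ) : Set where
    field
      size≥k  : k ≤ ∑ n L
      covered : uncovered L ≤ 1
      binary  : ∀ v → v < n → L v ≤ 1

  open Good public

  onlyParent≢0 : ∀ {u w} → onlyParent u w ≢ 0 → deg w ≡ 1 × A u w ≢ 0
  onlyParent≢0 {u} {w} ≢0 =
    ≤-antisym (m∸n≡0⇒m≤n (m+n≡0⇒m≡0 _ sum≡0)) (m∸n≡0⇒m≤n (m+n≡0⇒n≡0 (deg w ∸ 1) sum≡0)) ,
    1∸≡0 (m+n≡0⇒n≡0 (deg w ∸ 1 + (1 ∸ deg w)) all≡0)
    where
    all≡0 = 1∸≢0 ≢0
    sum≡0 = m+n≡0⇒m≡0 (deg w ∸ 1 + (1 ∸ deg w)) all≡0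

  onlyParent-intro : ∀ {u w} → deg w ≡ 1 → A u w ≢ 0 → onlyParent u w ≢ 0
  onlyParent-intro {u} {w} deg≡1 a≢0 rewrite deg≡1 | ≢0⇒1∸≡0 a≢0 = λ ()

  forced≢0 : ∀ {u} → forced u ≢ 0 → ∃[ w ] w < n × deg w ≡ 1 × A u w ≢ 0
  forced≢0 {u} ≢0 with w , w<n , o ← ∑≢0⇒∃ n (onlyParent u) ≢0 = w , w<n , onlyParent≢0 o

  forced-intro : ∀ {u w} → w < n → deg w ≡ 1 → A u w ≢ 0 → forced u ≢ 0
  forced-intro {u} {w} w<n deg≡1 a≢0 f≡0 = onlyParent-intro deg≡1 a≢0
    (n≤0⇒n≡0 (≤-trans (term≤∑ n (onlyParent u) w<n) (≤-reflexive f≡0)))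

  cover≢0 : ∀ {L w} → cover L w ≢ 0 → ∃[ u ] u < n × A u w ≢ 0 × L u ≡ 0
  cover≢0 {L} {w} ≢0 with u , u<n , t ← ∑≢0⇒∃ n _ ≢0 =
    u , u<n , 1∸≡0 (m+n≡0⇒m≡0 _ (1∸≢0 t)) , m+n≡0⇒n≡0 (1 ∸ A u w) (1∸≢0 t)

  cover-intro : ∀ {L u w} → u < n → A u w ≢ 0 → L u ≡ 0 → cover L w ≢ 0
  cover-intro {L} {u} {w} u<n a≢0 l≡0 c≡0 =
    1∸0≢0 (cong₂ _+_ (≢0⇒1∸≡0 a≢0) l≡0)
      (n≤0⇒n≡0 (≤-trans (term≤∑ n (λ u → 1 ∸ (1 ∸ A u w + L u)) u<n) (≤-reflexive c≡0)))

  deg-intro : ∀ {u w} → u < n → A u w ≢ 0 → deg w ≢ 0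
  deg-intro {u} {w} u<n a≢0 d≡0 = a≢0 (n≤0⇒n≡0 (≤-trans (term≤∑ n (λ u → A u w) u<n) (≤-reflexive d≡0)))

  deg≡0⇒cover≡0 : ∀ {L w} → deg w ≡ 0 → cover L w ≡ 0
  deg≡0⇒cover≡0 {L} {w} d≡0 with cover L w ≟ 0
  ... | yes c≡0 = c≡0
  ... | no c≢0 with u , u<n , a≢0 , _ ← cover≢0 c≢0 = contradiction d≡0 (deg-intro u<n a≢0)

  module _ (sources≡1 : sources ≡ 1) where

    source : ∃[ w ] w < n × deg w ≡ 0
    source with w , w<n , t ← ∑≢0⇒∃ n (λ w → 1 ∸ deg w) (λ s≡0 → contradiction (trans (sym sources≡1) s≡0) λ ()) =
      w , w<n , 1∸≢0 t

    private
      r = proj₁ source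
      r<n = proj₁ (proj₂ source)
      deg-r = proj₂ (proj₂ source)

    source-unique : ∀ {w} → w < n → deg w ≡ 0 → w ≡ r
    source-unique w<n d≡0 =
      ∑≤1⇒unique n _ (≤-reflexive sources≡1) w<n r<n (1∸0≢0 d≡0) (1∸0≢0 deg-r)

    uncovered≤1⇒covered : ∀ {L w} → uncovered L ≤ 1 → w < n → w ≢ r → cover L w ≢ 0
    uncovered≤1⇒covered {L} ≤1 w<n w≢r c≡0 =
      w≢r (∑≤1⇒unique n _ ≤1 w<n r<n (1∸0≢0 c≡0) (1∸0≢0 (deg≡0⇒cover≡0 {L} deg-r)))

    covered⇒uncovered≤1 : ∀ {L} → (∀ w → w < n → deg w ≢ 0 → cover L w ≢ 0) → uncovered L ≤ 1
    covered⇒uncovered≤1 {L} cov = unique⇒∑≤1 n _ r (λ w _ → 1∸≤1 (cover L w)) supp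
      where
      supp : ∀ w → w < n → 1 ∸ cover L w ≢ 0 → w ≡ r
      supp w w<n ≢0 with deg w ≟ 0
      ... | yes d≡0 = source-unique w<n d≡0
      ... | no d≢0 = contradiction (1∸≢0 ≢0) (cov w w<n d≢0)

    -- If `v` is the only parent of `w`, then `w` is not the source, so some in-neighbour outside
    -- `L` covers it; this can only be `v`.
    good⇒¬forced : ∀ {k L} → Good k L → ∀ v → v < n → L v ≢ 0 → forced v ≡ 0
    good⇒¬forced {L = L} good v v<n Lv≢0 with forced v ≟ 0
    ... | yes f≡0 = f≡0
    ... | no f≢0 with w , w<n , d≡1 , a≢0 ← forced≢0 f≢0
      with u , u<n , a′≢0 , Lu≡0 ← cover≢0 (uncovered≤1⇒covered {L} (covered good) w<n
             λ { refl → contradiction (trans (sym d≡1) deg-r) λ () })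
      = contradiction (trans (cong L v≡u) Lu≡0) Lv≢0
      where
      v≡u : v ≡ u
      v≡u = ∑≤1⇒unique n (λ u → A u w) (≤-reflexive d≡1) v<n u<n a≢0 a′≢0

    private
      one many : ℕ → ℕ
      one  w = 1 ∸ (deg w ∸ 1 + (1 ∸ deg w))
      many w = 1 ∸ (2 ∸ deg w)

      trichotomy : ∀ d → 1 ≡ 1 ∸ d + (1 ∸ (d ∸ 1 + (1 ∸ d))) + (1 ∸ (2 ∸ d))
      trichotomy 0 = refl
      trichotomy 1 = refl
      trichotomy (suc (suc d)) rewrite 0∸n≡0 d | 0∸n≡0 (d + 0) = refl

      ∑onlyParent≤one : ∀ w → ∑ n (λ u → onlyParent u w) ≤ one w
      ∑onlyParent≤one w with deg w ≟ 1
      ... | no d≢1 = ≤-trans (≤-reflexive (∑-zero n vanish)) z≤n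
        where
        vanish : ∀ u → u < n → onlyParent u w ≡ 0
        vanish u _ with onlyParent u w ≟ 0
        ... | yes ≡0 = ≡0
        ... | no ≢0 = contradiction (proj₁ (onlyParent≢0 ≢0)) d≢1
      ... | yes d≡1 = ≤-trans (∑-mono n λ u _ → onlyParent≤A u)
                        (≤-reflexive (trans d≡1 (sym (cong (λ d → 1 ∸ (d ∸ 1 + (1 ∸ d))) d≡1))))
        where
        onlyParent≤A : ∀ u → onlyParent u w ≤ A u w
        onlyParent≤A u with onlyParent u w ≟ 0
        ... | yes ≡0 = ≤-trans (≤-reflexive ≡0) z≤n
        ... | no ≢0 = ≤-trans (1∸≤1 (deg w ∸ 1 + (1 ∸ deg w) + (1 ∸ A u w))) (n≢0⇒n>0 (proj₂ (onlyParent≢0 ≢0)))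

    -- Two ways of counting all vertices are compared, by indegree and by forcedness. A vertex of
    -- indegree 1 adds 1 to `forced` at a single vertex, so `∑ n forced` cancels against `∑ n one`;
    -- what remains is the source, which makes the inequality strict.
    many<candidates : ∑ n many < candidates
    many<candidates = +-cancelˡ-≤ (∑ n one) _ _ (begin
      ∑ n one + suc (∑ n many)                    ≡⟨ +-suc (∑ n one) (∑ n many) ⟩
      1 + (∑ n one + ∑ n many)                    ≡⟨ cong (_+ (∑ n one + ∑ n many)) sources≡1 ⟨
      sources + (∑ n one + ∑ n many)              ≡⟨ +-assoc sources (∑ n one) (∑ n many) ⟨
      sources + ∑ n one + ∑ n many                ≡⟨ cong (_+ ∑ n many) (∑-+ n _ one) ⟨
      ∑ n (λ w → 1 ∸ deg w + one w) + ∑ n many    ≡⟨ ∑-+ n _ many ⟨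
      ∑ n (λ w → 1 ∸ deg w + one w + many w)      ≡⟨ ∑-cong n (λ w _ → trichotomy (deg w)) ⟨
      -- `forced v` counts children and may exceed 1, so only an inequality holds here.
      ∑ n (λ _ → 1)                               ≤⟨ ∑-mono n (λ v _ → m≤n+m∸n 1 (forced v)) ⟩
      ∑ n (λ v → forced v + (1 ∸ forced v))       ≡⟨ ∑-+ n forced _ ⟩
      ∑ n forced + candidates                     ≡⟨ cong (_+ candidates) (∑-swap n n onlyParent) ⟩
      ∑ n (λ w → ∑ n (λ u → onlyParent u w)) + candidates
                                                  ≤⟨ +-monoˡ-≤ candidates (∑-mono n λ w _ → ∑onlyParent≤one w) ⟩
      ∑ n one + candidates                        ∎)
      where open ≤-Reasoning

    private
      unforced : ℕ → List ℕ
      unforced m = filter (λ v → forced v ≟ 0) (downFrom m)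

      length-unforced : ∀ m → length (unforced m) ≡ ∑ m (λ v → 1 ∸ forced v)
      length-unforced zero = refl
      length-unforced (suc m) with forced m
      ... | zero  = trans (cong suc (length-unforced m)) (+-comm 1 _)
      ... | suc k = trans (length-unforced m) (sym (trans (cong (∑ m (λ v → 1 ∸ forced v) +_) (0∸n≡0 k)) (+-identityʳ _)))

      Parents : ℕ → ℕ × ℕ → Set
      Parents w (a , b) = (a < n × A a w ≢ 0) × (b < n × A b w ≢ 0)

      -- Two parents of each vertex are enough. A set that omits the forced vertices and a hitting
      -- set of the chosen pairs leaves out one of the two, and that one covers the vertex.
      parent-pairs : ∀ m → m ≤ n → ∃[ E ] length E ≤ ∑ m many × All (EdgeIn (unforced n)) E ×
        (∀ w → w < m → 2 ≤ deg w →
           (∃[ a ] a < n × A a w ≢ 0 × forced a ≢ 0) ⊎ (∃[ e ] e ∈ E × Parents w e))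
      parent-pairs zero _ = [] , z≤n , [] , λ _ ()
      parent-pairs (suc m) m<n with E , |E|≤ , E⊆ , spec ← parent-pairs m (<⇒≤ m<n) | 2 ≤? deg m
      ... | no ¬2≤ = E , ≤-trans |E|≤ (m≤m+n _ (many m)) , E⊆ , spec′
        where
        spec′ : ∀ w → w < suc m → 2 ≤ deg w → _
        spec′ w w<1+m 2≤ with m<1+n⇒m<n∨m≡n w<1+m
        ... | inj₁ w<m  = spec w w<m 2≤
        ... | inj₂ refl = contradiction 2≤ ¬2≤
      ... | yes 2≤ with a , b , a<n , b<n , a≢b , Aa , Ab ← 2≤∑⇒∃₂ n (λ u → A u m) (λ u _ → A≤1 u m) 2≤
        with forced a ≟ 0 | forced b ≟ 0
      ... | no fa | _ = E , ≤-trans |E|≤ (m≤m+n _ (many m)) , E⊆ , spec′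
        where
        spec′ : ∀ w → w < suc m → 2 ≤ deg w → _
        spec′ w w<1+m 2≤ with m<1+n⇒m<n∨m≡n w<1+m
        ... | inj₁ w<m  = spec w w<m 2≤
        ... | inj₂ refl = inj₁ (a , a<n , Aa , fa)
      ... | yes _ | no fb = E , ≤-trans |E|≤ (m≤m+n _ (many m)) , E⊆ , spec′
        where
        spec′ : ∀ w → w < suc m → 2 ≤ deg w → _
        spec′ w w<1+m 2≤ with m<1+n⇒m<n∨m≡n w<1+m
        ... | inj₁ w<m  = spec w w<m 2≤
        ... | inj₂ refl = inj₁ (b , b<n , Ab , fb)
      ... | yes fa | yes fb = (a , b) ∷ E ,
          ≤-trans (+-mono-≤ (n≢0⇒n>0 (1∸0≢0 (m≤n⇒m∸n≡0 2≤))) |E|≤) (≤-reflexive (+-comm (many m) _)) ,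
          (a≢b , ∈-filter⁺ _ (∈-downFrom⁺ a<n) fa , ∈-filter⁺ _ (∈-downFrom⁺ b<n) fb) ∷ E⊆ , spec′
        where
        spec′ : ∀ w → w < suc m → 2 ≤ deg w → _
        spec′ w w<1+m 2≤ with m<1+n⇒m<n∨m≡n w<1+m
        ... | inj₂ refl = inj₂ ((a , b) , here refl , (a<n , Aa) , (b<n , Ab))
        ... | inj₁ w<m with spec w w<m 2≤
        ...   | inj₁ x = inj₁ x
        ...   | inj₂ (e , e∈E , ps) = inj₂ (e , there e∈E , ps)

      -- The list `H` as a multiplicity function, to be subtracted pointwise from the indicator of
      -- the unforced vertices. Repeated entries do no harm, since only an upper bound for the sum
      -- is wanted.
      occurrences : List ℕ → ℕ → ℕ
      occurrences []      v = 0
      occurrences (h ∷ H) v = 1 ∸ ∣ v - h ∣ + occurrences H v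

      ∑occurrences≤length : ∀ H → ∑ n (occurrences H) ≤ length H
      ∑occurrences≤length [] = ≤-reflexive (∑-zero n λ _ _ → refl)
      ∑occurrences≤length (h ∷ H) = ≤-trans (≤-reflexive (∑-+ n _ (occurrences H)))
        (+-mono-≤ (unique⇒∑≤1 n _ h (λ v _ → 1∸≤1 ∣ v - h ∣) (λ v _ ≢0 → ∣m-n∣≡0⇒m≡n (1∸≢0 ≢0)))
                  (∑occurrences≤length H))

      ∈⇒occurrences≢0 : ∀ {H v} → v ∈ H → occurrences H v ≢ 0
      ∈⇒occurrences≢0 {h ∷ H} (here refl) ≡0 = 1∸0≢0 (∣n-n∣≡0 h) (m+n≡0⇒m≡0 _ ≡0)
      ∈⇒occurrences≢0 {h ∷ H} {v} (there v∈H) ≡0 = ∈⇒occurrences≢0 v∈H (m+n≡0⇒n≡0 (1 ∸ ∣ v - h ∣) ≡0)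

    many-candidates⇒good : ∀ k → 3 * k ≤ candidates → ∃[ L ] Good k L
    many-candidates⇒good k 3k≤
      with E , |E|≤ , E⊆ , pairs ← parent-pairs n ≤-refl
      with H , 3H≤ , hits ← hitting-set (length E) (unforced n) E ≤-refl E⊆
      = L , record { size≥k = *-cancelˡ-≤ 3 (≤-trans 3k≤ 3L≥) ; covered = covered⇒uncovered≤1 cov
                   ; binary = λ v _ → 1∸≤1 (forced v + occurrences H v) }
      where
      L : ℕ → ℕ
      L v = 1 ∸ (forced v + occurrences H v)

      N≤L+H : candidates ≤ ∑ n L + length H
      N≤L+H = begin
        candidates                        ≤⟨ ∑-mono n (λ v _ → m≤n+m∸n (1 ∸ forced v) (occurrences H v)) ⟩
        ∑ n (λ v → occurrences H v + (1 ∸ forced v ∸ occurrences H v))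
          ≡⟨ ∑-cong n (λ v _ → cong (occurrences H v +_) (∸-+-assoc 1 (forced v) (occurrences H v))) ⟩
        ∑ n (λ v → occurrences H v + L v) ≡⟨ ∑-+ n (occurrences H) L ⟩
        ∑ n (occurrences H) + ∑ n L       ≤⟨ +-monoˡ-≤ (∑ n L) (∑occurrences≤length H) ⟩
        length H + ∑ n L                  ≡⟨ +-comm (length H) _ ⟩
        ∑ n L + length H                  ∎
        where open ≤-Reasoning

      3L≥ : candidates ≤ 3 * ∑ n L
      -- Adding `2 * candidates` on both sides avoids a subtraction: it bounds `3 * length H`,
      -- because the graph has `candidates` vertices and fewer edges than that.
      3L≥ = +-cancelʳ-≤ (2 * candidates) _ _ (begin
        candidates + 2 * candidates     ≡⟨⟩
        3 * candidates                  ≤⟨ *-monoʳ-≤ 3 N≤L+H ⟩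
        3 * (∑ n L + length H)          ≡⟨ *-distribˡ-+ 3 (∑ n L) (length H) ⟩
        3 * ∑ n L + 3 * length H        ≤⟨ +-monoʳ-≤ (3 * ∑ n L) 3H≤ ⟩
        3 * ∑ n L + (length (unforced n) + length E)
          ≤⟨ +-monoʳ-≤ (3 * ∑ n L) (+-mono-≤ (≤-reflexive (length-unforced n)) (≤-trans |E|≤ (<⇒≤ many<candidates))) ⟩
        3 * ∑ n L + (candidates + candidates)
          ≡⟨ cong (λ z → 3 * ∑ n L + (candidates + z)) (+-identityʳ candidates) ⟨
        3 * ∑ n L + 2 * candidates      ∎)
        where open ≤-Reasoning

      forced⇒L≡0 : ∀ {u} → forced u ≢ 0 → L u ≡ 0
      forced⇒L≡0 {u} f≢0 = ≢0⇒1∸≡0 (λ ≡0 → f≢0 (m+n≡0⇒m≡0 (forced u) ≡0))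

      ∈H⇒L≡0 : ∀ {u} → u ∈ H → L u ≡ 0
      ∈H⇒L≡0 {u} u∈H = ≢0⇒1∸≡0 (λ ≡0 → ∈⇒occurrences≢0 u∈H (m+n≡0⇒n≡0 (forced u) ≡0))

      cov : ∀ w → w < n → deg w ≢ 0 → cover L w ≢ 0
      cov w w<n d≢0 with deg w ≟ 1
      ... | yes d≡1 with u , u<n , a≢0 ← ∑≢0⇒∃ n (λ u → A u w) d≢0 =
        cover-intro {L} u<n a≢0 (forced⇒L≡0 (forced-intro w<n d≡1 a≢0))
      ... | no d≢1 with pairs w w<n (≤∧≢⇒< (n≢0⇒n>0 d≢0) (≢-sym d≢1))
      ...   | inj₁ (a , a<n , Aa , fa) = cover-intro {L} a<n Aa (forced⇒L≡0 fa)
      ...   | inj₂ (e , e∈E , (a<n , Aa) , (b<n , Ab)) with hits e∈E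
      ...     | inj₁ a∈H = cover-intro {L} a<n Aa (∈H⇒L≡0 a∈H)
      ...     | inj₂ b∈H = cover-intro {L} b<n Ab (∈H⇒L≡0 b∈H)

  -- The unforced vertices in increasing order are the binary digits of a code.
  weight : ℕ → ℕ
  weight v = 2 ^ ∑ v (λ u → 1 ∸ forced u)

  code : ℕ → (ℕ → ℕ) → ℕ
  code m S = ∑ m (λ v → S v * weight v)

  Unforced : (ℕ → ℕ) → Set
  Unforced S = ∀ v → v < n → S v ≢ 0 → forced v ≡ 0

  module _ {S : ℕ → ℕ} (S≤1 : ∀ v → v < n → S v ≤ 1) (S-unforced : Unforced S) where

    -- The usual bound for a binary number. A forced vertex contributes no digit: `S` vanishes there
    -- and the weight does not double.
    code<weight : ∀ m → m ≤ n → code m S < weight m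
    code<weight zero    _   = ≤-refl
    code<weight (suc m) m<n with S m ≟ 0
    ... | yes S≡0 = ≤-trans (≤-reflexive (cong suc (trans (cong (λ s → code m S + s * weight m) S≡0) (+-identityʳ _))))
                      (≤-trans (code<weight m (<⇒≤ m<n)) (^-monoʳ-≤ 2 (m≤m+n (∑ m (λ u → 1 ∸ forced u)) (1 ∸ forced m))))
    ... | no S≢0 = begin-strict
      code m S + S m * weight m    ≤⟨ +-monoʳ-≤ (code m S) (*-monoˡ-≤ (weight m) (S≤1 m m<n)) ⟩
      code m S + 1 * weight m      <⟨ +-monoˡ-< (1 * weight m) (code<weight m (<⇒≤ m<n)) ⟩
      weight m + 1 * weight m      ≡⟨⟩
      2 ^ (1 + ∑ m (λ u → 1 ∸ forced u))
        ≡⟨ cong (2 ^_) (+-comm 1 (∑ m (λ u → 1 ∸ forced u))) ⟩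
      2 ^ (∑ m (λ u → 1 ∸ forced u) + 1)
        ≡⟨ cong (λ f → 2 ^ (∑ m (λ u → 1 ∸ forced u) + (1 ∸ f))) (S-unforced m m<n S≢0) ⟨
      weight (suc m)               ∎
      where open ≤-Reasoning

    -- `code (suc m) S` is what remains when the digits above `m` have been subtracted, and the
    -- digit at `m` is 1 exactly if `weight m` fits into it. A forced vertex needs no test of its
    -- own: there `weight m` equals `weight (suc m)`, which exceeds the remainder.
    decode-bit : ∀ m → m < n → 1 ∸ (weight m ∸ code (suc m) S) ≡ S m
    decode-bit m m<n with S m | S≤1 m m<n
    ... | 0 | _ = ≢0⇒1∸≡0 (λ ≡0 → <⇒≱ (code<weight m (<⇒≤ m<n))
                    (≤-trans (m∸n≡0⇒m≤n ≡0) (≤-reflexive (+-identityʳ _))))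
    ... | 1 | _ = cong (1 ∸_) (m≤n⇒m∸n≡0 (≤-trans (≤-reflexive (sym (*-identityˡ _))) (m≤n+m _ (code m S))))
    ... | suc (suc _) | s≤s ()

-- Counting subsets of `Fin n` by sums

indicator : Bool → ℕ
indicator b = if b then 1 else 0

∣tabulate∣≡∑ : ∀ {n} (g : Fin n → Bool) f → (∀ i → f (toℕ i) ≡ indicator (g i)) → ∣ tabulate g ∣ ≡ ∑ n f
∣tabulate∣≡∑ {zero}  g f f≡g = refl
∣tabulate∣≡∑ {suc n} g f f≡g
  rewrite ∑-first n f | sym (∣tabulate∣≡∑ (g ∘ Fin.suc) (f ∘ suc) (f≡g ∘ Fin.suc)) | f≡g Fin.zero
  with g Fin.zero
... | true  = refl
... | false = refl

∣tabulate∣≡0⇒false : ∀ {n} (g : Fin n → Bool) → ∣ tabulate g ∣ ≡ 0 → ∀ i → g i ≢ true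
∣tabulate∣≡0⇒false g ≡0 Fin.zero gi rewrite gi = contradiction ≡0 λ ()
∣tabulate∣≡0⇒false g ≡0 (Fin.suc i) gi with g Fin.zero
... | false = ∣tabulate∣≡0⇒false (g ∘ Fin.suc) ≡0 i gi
∣tabulate∣≡0⇒false g () (Fin.suc i) gi | true

∣tabulate∣≢0⇒true : ∀ {n} (g : Fin n → Bool) → ∣ tabulate g ∣ ≢ 0 → ∃[ i ] g i ≡ true
∣tabulate∣≢0⇒true {zero} g ≢0 = contradiction refl ≢0
∣tabulate∣≢0⇒true {suc n} g ≢0 with g Fin.zero in g0
... | true  = Fin.zero , g0
... | false with i , gi ← ∣tabulate∣≢0⇒true (g ∘ Fin.suc) ≢0 = Fin.suc i , gi

false⇒∣tabulate∣≡0 : ∀ {n} (g : Fin n → Bool) → (∀ i → g i ≢ true) → ∣ tabulate g ∣ ≡ 0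
false⇒∣tabulate∣≡0 g g≢true with ∣ tabulate g ∣ ≟ 0
... | yes ≡0 = ≡0
... | no ≢0 with i , gi ← ∣tabulate∣≢0⇒true g ≢0 = contradiction gi (g≢true i)

toArray : ∀ {n} → (Fin n → ℕ) → ℕ → ℕ
toArray {n} g v with v <? n
... | yes v<n = g (fromℕ< v<n)
... | no _    = 0

toArray-toℕ : ∀ {n} (g : Fin n → ℕ) i → toArray g (toℕ i) ≡ g i
toArray-toℕ {n} g i with toℕ i <? n
... | yes i<n = cong g (fromℕ<-toℕ i i<n)
... | no i≮n  = contradiction (toℕ<n i) i≮n

on-Fin : ∀ {n} (P : ℕ → Set) → (∀ (i : Fin n) → P (toℕ i)) → ∀ v → v < n → P v
on-Fin P Pi v v<n = subst P (toℕ-fromℕ< v<n) (Pi (fromℕ< v<n))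

-- Acyclic digraphs and out-branchings

Unique⇒lookup-injective : ∀ {A : Set} {xs : List A} → Unique xs → ∀ {i j} → lookup xs i ≡ lookup xs j → i ≡ j
Unique⇒lookup-injective (x∉ ∷ u) {Fin.zero}  {Fin.zero}  eq = refl
Unique⇒lookup-injective (x∉ ∷ u) {Fin.zero}  {Fin.suc j} eq = contradiction eq (All.lookup x∉ (∈-lookup j))
Unique⇒lookup-injective (x∉ ∷ u) {Fin.suc i} {Fin.zero}  eq = contradiction (sym eq) (All.lookup x∉ (∈-lookup i))
Unique⇒lookup-injective (x∉ ∷ u) {Fin.suc i} {Fin.suc j} eq = cong Fin.suc (Unique⇒lookup-injective u eq)

Unique⇒length≤ : ∀ {n} {xs : List (Fin n)} → Unique xs → length xs ≤ n
Unique⇒length≤ u = injective⇒≤ (Unique⇒lookup-injective u)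

-- `ps` is the part of `xs` before `u`, the stretch that is left when a path returning to `u` is
-- closed to a cycle. The start `y` is quantified because it moves along the list in the recursion.
cut : ∀ {A : Set} {R : Rel A 0ℓ} {u : A} {xs} → u ∈ xs →
      ∃[ ps ] (∀ {P : A → Set} → All P xs → All P ps) × (Unique xs → Unique (u ∷ ps)) ×
              (∀ y → Linked R (y ∷ xs) → Linked R (y ∷ (ps ∷ʳ u)))
cut (here refl) = [] , (λ _ → []) , (λ _ → [] ∷ []) , λ { y (Ryu ∷ _) → Ryu ∷ [-] }
cut {R = R} {u} {x ∷ xs} (there u∈xs) with ps , all , unique , linked ← cut {R = R} u∈xs =
  x ∷ ps , (λ { (px ∷ pxs) → px ∷ all pxs }) ,
  (λ { (x∉xs ∷ uxs) → insert x∉xs (all x∉xs) (unique uxs) }) ,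
  λ { y (Ryx ∷ l) → Ryx ∷ linked x l }
  where
  insert : ∀ {ps} → All (x ≢_) xs → All (x ≢_) ps → Unique (u ∷ ps) → Unique (u ∷ x ∷ ps)
  insert x∉xs x∉ps (u∉ps ∷ ups) = (≢-sym (All.lookup x∉xs u∈xs) ∷ u∉ps) ∷ (x∉ps ∷ ups)

module _ {n} (D : Digraph n) (acyclic : Acyclic D) where

  private
    -- Predecessors are explored along a path of distinct vertices. A predecessor on the path would
    -- close a cycle; any other lengthens the path, which has at most `n` vertices, so the fuel
    -- lasts.
    path-accessible : ∀ fuel v vs → n ≤ fuel + length vs → Unique (v ∷ vs) → Linked (Arc D) (v ∷ vs) → Acc (Arc D) v
    path-accessible zero v vs n≤ u l = contradiction (Unique⇒length≤ u) (≤⇒≯ n≤)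
    path-accessible (suc fuel) v vs n≤ u l = acc predecessor
      where
      predecessor : ∀ {w} → Arc D w v → Acc (Arc D) w
      predecessor {w} Awv with _∈?_ Fin._≟_ w (v ∷ vs)
      ... | no w∉ = path-accessible fuel w (v ∷ vs) (≤-trans n≤ (≤-reflexive (sym (+-suc fuel _))))
                      (All.tabulate (λ x∈ w≡x → w∉ (subst (_∈ v ∷ vs) (sym w≡x) x∈)) ∷ u) (Awv ∷ l)
      ... | yes w∈ with ps , _ , unique , linked ← cut {R = Arc D} w∈ =
        contradiction (unique u , linked w (Awv ∷ l)) (acyclic w ps)

  arc-wellFounded : WellFounded (Arc D)
  arc-wellFounded v = path-accessible n v [] (m≤m+n n 0) ([] ∷ []) [-]

  arc⁺-irreflexive : ∀ {v} → ¬ TransClosure (Arc D) v v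
  arc⁺-irreflexive = wf⇒irrefl (resp₂ _) sym (Plus.wellFounded _ arc-wellFounded) refl

  source-exists : Fin n → ∃[ r ] (∀ u → ¬ Arc D u r)
  source-exists v = go v (arc-wellFounded v)
    where
    go : ∀ v → Acc (Arc D) v → ∃[ r ] (∀ u → ¬ Arc D u r)
    go v (acc rs) with any? (λ u → arc D u v Bool.≟ true)
    ... | yes (u , Auv) = go u (rs Auv)
    ... | no ¬∃ = v , λ u Auv → ¬∃ (u , Auv)

  module _ (T : Digraph n) (T⊆D : ∀ u v → Arc T u v → Arc D u v) (r : Fin n)
           (no-parent : ∀ u → ¬ Arc T u r)
           (parent-unique : ∀ {u u′ v} → Arc T u v → Arc T u′ v → u ≡ u′)
           (parent : ∀ v → v ≢ r → ∃[ u ] Arc T u v) where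

    private
      irreflexive : ∀ {v} → ¬ TransClosure (Arc T) v v
      irreflexive = arc⁺-irreflexive ∘ map⁺
        where
        map⁺ : ∀ {u v} → TransClosure (Arc T) u v → TransClosure (Arc D) u v
        map⁺ Plus.[ a ]   = Plus.[ T⊆D _ _ a ]
        map⁺ (a ∷ p) = T⊆D _ _ a ∷ map⁺ p

      from-root : ∀ v → Acc (Arc D) v → EqClosure (Arc T) r v
      from-root v (acc rs) with v Fin.≟ r
      ... | yes refl = ε
      ... | no v≢r with u , Auv ← parent v v≢r =
        Equivalence.transitive (Arc T) (from-root u (rs (T⊆D u v Auv))) (fwd Auv ◅ ε)

      -- A walk that does not turn back keeps going down once it goes down,
      -- since going up is going to the unique parent.
      stays-down : ∀ x y ys z → Arc T x y → Linked (Edge T) (y ∷ (ys ∷ʳ z)) → Unique (x ∷ y ∷ ys) →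
                   All (_≢ z) (x ∷ y ∷ ys) →
                   TransClosure (Arc T) y z × ∃[ l ] l ∈ y ∷ ys × Arc T l z
      stays-down x y [] z x→y (fwd y→z ∷ _) _ _ = Plus.[ y→z ] , y , here refl , y→z
      stays-down x y [] z x→y (bwd z→y ∷ _) _ (x≢z ∷ _) = contradiction (parent-unique x→y z→y) x≢z
      stays-down x y (y′ ∷ ys) z x→y (bwd y′→y ∷ l) ((_ ∷ x≢y′ ∷ _) ∷ _) _ =
        contradiction (parent-unique x→y y′→y) x≢y′
      stays-down x y (y′ ∷ ys) z x→y (fwd y→y′ ∷ l) (_ ∷ u) (_ ∷ ≢z)
        with p , w , w∈ , w→z ← stays-down y y′ ys z y→y′ l u ≢z = y→y′ ∷ p , w , there w∈ , w→z

      -- A walk that keeps going up traces a directed path from `z` to `y`; once it turns down it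
      -- stays down, so its last arc enters `z`.
      up-or-down : ∀ y ys z → Linked (Edge T) (y ∷ (ys ∷ʳ z)) → Unique (y ∷ ys) → All (_≢ z) (y ∷ ys) →
                   TransClosure (Arc T) z y ⊎ (∃[ l ] l ∈ y ∷ ys × Arc T l z)
      up-or-down y [] z (fwd y→z ∷ _) _ _ = inj₂ (y , here refl , y→z)
      up-or-down y [] z (bwd z→y ∷ _) _ _ = inj₁ Plus.[ z→y ]
      up-or-down y (y′ ∷ ys) z (fwd y→y′ ∷ l) u ≢z
        with _ , w , w∈ , w→z ← stays-down y y′ ys z y→y′ l u ≢z = inj₂ (w , there w∈ , w→z)
      up-or-down y (y′ ∷ ys) z (bwd y′→y ∷ l) (_ ∷ u) (_ ∷ ≢z) with up-or-down y′ ys z l u ≢z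
      ... | inj₁ p = inj₁ (p Plus.∷ʳ y′→y)
      ... | inj₂ (w , w∈ , w→z) = inj₂ (w , there w∈ , w→z)

      -- Either all arcs of the cycle point the same way round, against irreflexivity, or two of
      -- them meet head to head, against uniqueness of parents. The directions of the first two
      -- steps decide how the rest of the cycle is treated.
      no-undirected-cycle : ∀ v vs → 2 ≤ length vs → ¬ IsCycle (Edge T) v vs
      no-undirected-cycle v (_ ∷ []) (s≤s ()) _
      no-undirected-cycle v (v₁ ∷ v₂ ∷ vs) _ ((v≢v₁ ∷ v≢v₂ ∷ v≢vs) ∷ u , fwd v→v₁ ∷ bwd v₂→v₁ ∷ l) =
        v≢v₂ (parent-unique v→v₁ v₂→v₁)
      no-undirected-cycle v (v₁ ∷ v₂ ∷ vs) _ ((v≢ ∷ v≢s) ∷ u , fwd v→v₁ ∷ fwd v₁→v₂ ∷ l)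
        with p , _ ← stays-down v₁ v₂ vs v v₁→v₂ l u (All.map ≢-sym (v≢ ∷ v≢s)) =
        irreflexive (v→v₁ ∷ v₁→v₂ ∷ p)
      no-undirected-cycle v (v₁ ∷ v₂ ∷ vs) _ ((v≢ ∷ v≢s) ∷ u , bwd v₁→v ∷ fwd v₁→v₂ ∷ l)
        with _ , w , w∈ , w→v ← stays-down v₁ v₂ vs v v₁→v₂ l u (All.map ≢-sym (v≢ ∷ v≢s))
        with v₁∉ ∷ _ ← u = All.lookup v₁∉ w∈ (parent-unique v₁→v w→v)
      no-undirected-cycle v (v₁ ∷ v₂ ∷ vs) _ ((v≢ ∷ v≢s) ∷ (v₁∉ ∷ u) , bwd v₁→v ∷ bwd v₂→v₁ ∷ l)
        with up-or-down v₂ vs v l u (All.map ≢-sym v≢s)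
      ... | inj₁ p = irreflexive (p Plus.++ v₂→v₁ ∷ Plus.[ v₁→v ])
      ... | inj₂ (w , w∈ , w→v) = All.lookup v₁∉ w∈ (parent-unique v₁→v w→v)

    parent-choice⇒outBranching : IsOutBranching D T
    parent-choice⇒outBranching = record
      { subdigraph = T⊆D
      ; out-tree = record
        { tree = record
          { oriented = λ u v u→v v→u → irreflexive (u→v ∷ Plus.[ v→u ])
          ; connected = λ u v → Equivalence.transitive (Arc T)
              (Equivalence.symmetric (Arc T) (from-root u (arc-wellFounded u)))
              (from-root v (arc-wellFounded v))
          ; no-cycle = no-undirected-cycle
          }
        ; root = r , false⇒∣tabulate∣≡0 _ no-parent , root-unique
        }
      }
      where
      root-unique : ∀ {v} → indegree T v ≡ 0 → r ≡ v
      root-unique {v} ≡0 with v Fin.≟ r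
      ... | yes v≡r = sym v≡r
      ... | no v≢r with u , u→v ← parent v v≢r = contradiction u→v (∣tabulate∣≡0⇒false _ ≡0 u)

-- Good leaf sets versus out-branchings

indicator≤1 : ∀ b → indicator b ≤ 1
indicator≤1 true  = ≤-refl
indicator≤1 false = z≤n

matrix≤1 : ∀ {n} (D : Digraph n) m → matrix D m ≤ 1
matrix≤1 {n} D m with m <? n * n
... | yes m<n² = indicator≤1 (uncurry (arc D) (remQuot n (fromℕ< m<n²)))
... | no _     = z≤n

module _ {n : ℕ} (D : Digraph n) where

  adjacency : ℕ → ℕ → ℕ
  adjacency u w = matrix D (n * u + w)

  open LeafSets n adjacency (λ u w → matrix≤1 D (n * u + w)) public

module _ {n : ℕ} {D : Digraph n} where

  Arc⇒adjacency : ∀ {u w} → Arc D u w → adjacency D (toℕ u) (toℕ w) ≢ 0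
  Arc⇒adjacency {u} {w} a ≡0 =
    contradiction (trans (sym (trans (matrix-entry D u w) (cong indicator a))) ≡0) λ ()

  adjacency⇒Arc : ∀ {u w} → adjacency D (toℕ u) (toℕ w) ≢ 0 → Arc D u w
  adjacency⇒Arc {u} {w} ≢0 with arc D u w in eq
  ... | true  = refl
  ... | false = contradiction (trans (matrix-entry D u w) (cong indicator eq)) ≢0

  leaf : Fin n → Bool
  leaf v = does (outdegree D v ≟ 0)

  leaf⇒no-child : ∀ {u v} → leaf u ≡ true → ¬ Arc D u v
  leaf⇒no-child {u} {v} l with outdegree D u ≟ 0
  ... | yes ≡0 = ∣tabulate∣≡0⇒false _ ≡0 v
  ... | no ≢0  = contradiction (trans (sym l) (dec-false (outdegree D u ≟ 0) ≢0)) λ ()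

  no-child⇒leaf : ∀ {u} → (∀ v → ¬ Arc D u v) → leaf u ≡ true
  no-child⇒leaf {u} ¬a = dec-true (outdegree D u ≟ 0) (false⇒∣tabulate∣≡0 _ ¬a)

module ParentChoice {n : ℕ} (D : Digraph n) (acyclic : Acyclic D) (r : Fin n)
                    (L : ℕ → ℕ) (L≤1 : ∀ v → v < n → L v ≤ 1)
                    (parentOf : ∀ v → v ≢ r → ∃[ u ] Arc D u v × L (toℕ u) ≡ 0)
  where

  isParent : Fin n → Fin n → Bool
  isParent u v with v Fin.≟ r
  ... | yes _  = false
  ... | no v≢r = does (u Fin.≟ proj₁ (parentOf v v≢r))

  isParent-root : ∀ u → isParent u r ≢ true
  isParent-root u eq with r Fin.≟ r
  ... | no r≢r = r≢r refl

  isParent⇒parentOf : ∀ {u v} → isParent u v ≡ true → ∃[ v≢r ] u ≡ proj₁ (parentOf v v≢r)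
  isParent⇒parentOf {u} {v} eq with v Fin.≟ r
  ... | no v≢r with u Fin.≟ proj₁ (parentOf v v≢r)
  ...   | yes u≡ = v≢r , u≡

  isParent-unique : ∀ {u u′ v} → isParent u v ≡ true → isParent u′ v ≡ true → u ≡ u′
  isParent-unique {u} {u′} {v} eq eq′ with v Fin.≟ r
  ... | no v≢r with u Fin.≟ proj₁ (parentOf v v≢r) | u′ Fin.≟ proj₁ (parentOf v v≢r)
  ...   | yes u≡ | yes u′≡ = trans u≡ (sym u′≡)

  isParent-exists : ∀ v → v ≢ r → ∃[ u ] isParent u v ≡ true
  isParent-exists v v≢r with v Fin.≟ r
  ... | yes v≡r = contradiction v≡r v≢r
  ... | no v≢r′ = u , dec-true (u Fin.≟ u) refl where u = proj₁ (parentOf v v≢r′)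

  chosen : ∀ {u v} → isParent u v ≡ true → Arc D u v × L (toℕ u) ≡ 0
  chosen {u} {v} eq with v≢r , refl ← isParent⇒parentOf {u} {v} eq = proj₂ (parentOf v v≢r)

  T : Digraph n
  T = record { arc = isParent ; no-loop = λ v → Bool.¬-not λ eq →
    contradiction (trans (sym (proj₁ (chosen {v} {v} eq))) (no-loop D v)) λ () }

  chosen-outBranching : IsOutBranching D T
  chosen-outBranching = parent-choice⇒outBranching D acyclic T (λ u v → proj₁ ∘ chosen {u} {v}) r
    isParent-root (λ {u} {u′} {v} → isParent-unique {u} {u′} {v}) isParent-exists

  -- Parents are chosen outside `L`, so a vertex of `L` has no child in `T`.
  L⇒leaf : ∀ v → L (toℕ v) ≢ 0 → leaf {D = T} v ≡ true
  L⇒leaf v Lv≢0 = no-child⇒leaf {D = T} childless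
    where
    childless : ∀ w → ¬ Arc T v w
    childless w v→w = Lv≢0 (proj₂ (chosen {v} {w} v→w))

  L≤leaves : ∑ n L ≤ ∣ leaves T ∣
  L≤leaves = ≤-trans (∑-mono n (on-Fin (λ v → L v ≤ leafArray v) L≤))
               (≤-reflexive (sym (∣tabulate∣≡∑ (leaf {D = T}) leafArray (toArray-toℕ _))))
    where
    leafArray : ℕ → ℕ
    leafArray = toArray (λ v → indicator (leaf {D = T} v))
    L≤ : ∀ v → L (toℕ v) ≤ leafArray (toℕ v)
    L≤ v rewrite toArray-toℕ (λ v → indicator (leaf {D = T} v)) v with L (toℕ v) ≟ 0
    ... | yes ≡0 = ≤-trans (≤-reflexive ≡0) z≤n
    ... | no ≢0 = ≤-trans (L≤1 _ (toℕ<n v)) (≤-reflexive (sym (cong indicator (L⇒leaf v ≢0))))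

module _ {n k : ℕ} {D : Digraph n} (acyclic : Acyclic D) where

  module _ (o : Fin n) (branching : DMLOB D k) where

    private
      T = proj₁ branching
      open IsOutBranching (proj₁ (proj₂ branching))
      open IsOutTree out-tree
      r = proj₁ root

      parent : ∀ {v} → v ≢ r → ∃[ u ] Arc T u v
      parent {v} v≢r = ∣tabulate∣≢0⇒true _ (λ ≡0 → v≢r (sym (proj₂ (proj₂ root) ≡0)))

      L : ℕ → ℕ
      L = toArray (λ v → indicator (leaf {D = T} v))

      parent∉L : ∀ {u v} → Arc T u v → L (toℕ u) ≡ 0
      parent∉L {u} u→v = trans (toArray-toℕ _ u) (cong indicator
        (Bool.¬-not λ l → leaf⇒no-child {D = T} l u→v))

      supp : ∀ {f : ℕ → ℕ} → (∀ v → v ≢ r → f (toℕ v) ≡ 0) → ∀ w → w < n → f w ≢ 0 → w ≡ toℕ r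
      supp {f} f≡0 = on-Fin (λ w → f w ≢ 0 → w ≡ toℕ r) supp′
        where
        supp′ : ∀ v → f (toℕ v) ≢ 0 → toℕ v ≡ toℕ r
        supp′ v ≢0 with v Fin.≟ r
        ... | yes refl = refl
        ... | no v≢r   = contradiction (f≡0 v v≢r) ≢0

    -- A parent in `T` is a parent in `D`, so every source of `D` is the root of `T`. That a source
    -- exists follows from acyclicity, by climbing from `o`.
    outBranching⇒one-source : sources D ≡ 1
    outBranching⇒one-source = ≤-antisym
      (unique⇒∑≤1 n _ (toℕ r) (λ w _ → 1∸≤1 (deg D w)) (supp λ v v≢r →
        let u , u→v = parent v≢r in
        ≢0⇒1∸≡0 (deg-intro D (toℕ<n u) (Arc⇒adjacency {D = D} (subdigraph u v u→v)))))
      (n≢0⇒n>0 λ ≡0 → 1∸0≢0 deg≡0 (n≤0⇒n≡0 (≤-trans (term≤∑ n _ (toℕ<n s)) (≤-reflexive ≡0))))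
      where
      s = proj₁ (source-exists D acyclic o)
      deg≡0 : deg D (toℕ s) ≡ 0
      deg≡0 = ∑-zero n (on-Fin (λ u → adjacency D u (toℕ s) ≡ 0) no-arc)
        where
        no-arc : ∀ u → adjacency D (toℕ u) (toℕ s) ≡ 0
        no-arc u with adjacency D (toℕ u) (toℕ s) ≟ 0
        ... | yes ≡0 = ≡0
        ... | no ≢0  = contradiction (adjacency⇒Arc {D = D} ≢0) (proj₂ (source-exists D acyclic o) u)

    -- `L` is the set of leaves of `T`. The parent in `T` of a vertex other than the root is no
    -- leaf, and so covers that vertex.
    outBranching⇒good : ∃[ L ] Good D k L
    outBranching⇒good = L , record
      { size≥k  = ≤-trans (proj₂ (proj₂ branching)) (≤-reflexive (∣tabulate∣≡∑ (leaf {D = T}) L (toArray-toℕ _)))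
      ; covered = unique⇒∑≤1 n _ (toℕ r) (λ w _ → 1∸≤1 (cover D L w)) (supp λ v v≢r →
          let u , u→v = parent v≢r in
          ≢0⇒1∸≡0 (cover-intro D {L} (toℕ<n u) (Arc⇒adjacency {D = D} (subdigraph u v u→v)) (parent∉L u→v)))
      ; binary  = on-Fin (λ v → L v ≤ 1) λ v →
          ≤-trans (≤-reflexive (toArray-toℕ _ v)) (indicator≤1 (leaf {D = T} v))
      }

  module _ (sources≡1 : sources D ≡ 1) {L : ℕ → ℕ} (good : Good D k L) where

    private
      r : Fin n
      r = fromℕ< (proj₁ (proj₂ (source D sources≡1)))

      toℕ-r : toℕ r ≡ proj₁ (source D sources≡1)
      toℕ-r = toℕ-fromℕ< _

      toFin : ∀ {v} → ∃[ u ] u < n × adjacency D u (toℕ v) ≢ 0 × L u ≡ 0 →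
              ∃[ u ] Arc D u v × L (toℕ u) ≡ 0
      toFin {v} (u , u<n , a , Lu≡0) = fromℕ< u<n ,
        adjacency⇒Arc {D = D} (subst (λ x → adjacency D x (toℕ v) ≢ 0) (sym (toℕ-fromℕ< u<n)) a) ,
        trans (cong L (toℕ-fromℕ< u<n)) Lu≡0

      parentOf : ∀ v → v ≢ r → ∃[ u ] Arc D u v × L (toℕ u) ≡ 0
      parentOf v v≢r = toFin (cover≢0 D {L} (uncovered≤1⇒covered D sources≡1 {L} (covered good) (toℕ<n v)
        (λ eq → v≢r (toℕ-injective (trans eq (sym toℕ-r))))))

    good⇒outBranching : DMLOB D k
    good⇒outBranching = T , chosen-outBranching , ≤-trans (size≥k good) L≤leaves
      where open ParentChoice D acyclic r L (binary good) parentOf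

-- Programs

update-same : ∀ {A : Set} (f : ℕ → A) x a → (f [ x ↦ a ]) x ≡ a
update-same f x a rewrite dec-true (x ≟ x) refl = refl

update-other : ∀ {A : Set} (f : ℕ → A) {x y} a → y ≢ x → (f [ x ↦ a ]) y ≡ f y
update-other f {x} {y} a y≢x rewrite dec-false (y ≟ x) y≢x = refl

-- Syntactic, so that for a concrete program `writesRegister p x ≡ false` is proved by `refl`.
writesRegister : Program → ℕ → Bool
writesRegister skip x = false
writesRegister (y ≔ e) x = does (x ≟ y)
writesRegister (a [ e ]≔ f) x = false
writesRegister (p ⨾ q) x = writesRegister p x ∨ writesRegister q x
writesRegister (ifnz e p q) x = writesRegister p x ∨ writesRegister q x
writesRegister (whilenz e p) x = writesRegister p x

writesArray : Program → ℕ → Bool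
writesArray skip a = false
writesArray (x ≔ e) a = false
writesArray (b [ e ]≔ f) a = does (a ≟ b)
writesArray (p ⨾ q) a = writesArray p a ∨ writesArray q a
writesArray (ifnz e p q) a = writesArray p a ∨ writesArray q a
writesArray (whilenz e p) a = writesArray p a

record Frame (p : Program) (s s′ : State) : Set where
  constructor frame
  field
    reg : ∀ x → writesRegister p x ≡ false → register s′ x ≡ register s x
    arr : ∀ a → writesArray p a ≡ false → array s′ a ≡ array s a

open Frame public

Frame-refl : ∀ {p s} → Frame p s s
Frame-refl = frame (λ _ _ → refl) (λ _ _ → refl)

Frame-trans : ∀ {p s s′ s″} → Frame p s s′ → Frame p s′ s″ → Frame p s s″
Frame-trans f g = frame (λ x w → trans (reg g x w) (reg f x w)) (λ a w → trans (arr g a w) (arr f a w))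

Frame-seqˡ : ∀ {p q s s′} → Frame p s s′ → Frame (p ⨾ q) s s′
Frame-seqˡ f = frame (λ x → reg f x ∘ Bool.∨-conicalˡ _ _) (λ a → arr f a ∘ Bool.∨-conicalˡ _ _)

Frame-seqʳ : ∀ {p q s s′} → Frame q s s′ → Frame (p ⨾ q) s s′
Frame-seqʳ f = frame (λ x → reg f x ∘ Bool.∨-conicalʳ _ _) (λ a → arr f a ∘ Bool.∨-conicalʳ _ _)

Frame-while : ∀ {e p s s′} → Frame p s s′ → Frame (whilenz e p) s s′
Frame-while (frame r a) = frame r a

Frame-assign : ∀ {x e s} v → Frame (x ≔ e) s (setRegister x v s)
Frame-assign {x} {e} {s} v = frame (λ y w → cong (λ b → if b then v else register s y) w) (λ _ _ → refl)

⇓⇒Frame : ∀ {p s s′ t} → p , s ⇓ s′ , t → Frame p s s′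
⇓⇒Frame skip = Frame-refl
⇓⇒Frame assign = Frame-assign _
⇓⇒Frame {s = s} (store {b} {e} {f}) = frame (λ _ _ → refl) λ a w →
  cong (λ written → if written then array s b [ ⟦ e ⟧ s ↦ ⟦ f ⟧ s ] else array s a) w
⇓⇒Frame (seq d d′) = Frame-trans (Frame-seqˡ (⇓⇒Frame d)) (Frame-seqʳ (⇓⇒Frame d′))
⇓⇒Frame (if-nonzero _ d) with frame r a ← ⇓⇒Frame d =
  frame (λ x → r x ∘ Bool.∨-conicalˡ _ _) (λ b → a b ∘ Bool.∨-conicalˡ _ _)
⇓⇒Frame (if-zero _ d) with frame r a ← ⇓⇒Frame d =
  frame (λ x → r x ∘ Bool.∨-conicalʳ _ _) (λ b → a b ∘ Bool.∨-conicalʳ _ _)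
⇓⇒Frame {p} (while-nonzero _ d d′) with frame r a ← ⇓⇒Frame d =
  Frame-trans (frame r a) (⇓⇒Frame d′)
⇓⇒Frame (while-zero _) = Frame-refl

-- The cost of one pass through each loop, so that the running time is at most
-- size p times the number of iterations of the innermost loop.
size : Program → ℕ
size skip = 1
size (x ≔ e) = 1 + cost e
size (a [ e ]≔ f) = 1 + cost e + cost f
size (p ⨾ q) = size p + size q
size (ifnz e p q) = 1 + cost e + (size p + size q)
size (whilenz e p) = (1 + cost e) + (1 + cost e) + size p

-- Total correctness from a fixed start state. The time bound is linear in `X`, so that sequencing
-- adds sizes and a loop multiplies `X` by its number of passes.
record Runs (p : Program) (s : State) (X : ℕ) (Q : State → Set) : Set where
  constructor runs
  field
    {final}    : State
    {time}     : ℕ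
    derivation : p , s ⇓ final , time
    time≤      : time ≤ size p * X
    post       : Q final

private variable
  p q     : Program
  s s′    : State
  X Y n a : ℕ
  x       : ℕ
  Q R     : State → Set
  e f     : Exp

skip-runs : .{{_ : NonZero X}} → Q s → Runs skip s X Q
skip-runs {X} q = runs skip (m≤m*n 1 X) q

assign-runs : .{{_ : NonZero X}} → Q (setRegister x (⟦ e ⟧ s) s) → Runs (x ≔ e) s X Q
assign-runs {X} q = runs assign (m≤m*n _ X) q

store-runs : .{{_ : NonZero X}} → Q (setArray a (⟦ e ⟧ s) (⟦ f ⟧ s) s) → Runs (a [ e ]≔ f) s X Q
store-runs {X} q = runs store (m≤m*n _ X) q

seq-runs : Runs p s X Q → (∀ s′ → Frame p s s′ → Q s′ → Runs q s′ X R) → Runs (p ⨾ q) s X R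
seq-runs {p} {X = X} {q = q} (runs d t≤ post) k with k _ (⇓⇒Frame d) post
... | runs d′ t′≤ post′ =
  runs (seq d d′) (≤-trans (+-mono-≤ t≤ t′≤) (≤-reflexive (sym (*-distribʳ-+ X (size p) (size q))))) post′

if-runs : .{{_ : NonZero X}} →
          (⟦ e ⟧ s ≢ 0 → Runs p s X Q) → (⟦ e ⟧ s ≡ 0 → Runs q s X Q) → Runs (ifnz e p q) s X Q
if-runs {X} {e} {s} {p} {q = q} k k′ with ⟦ e ⟧ s ≟ 0
... | no e≢0 with runs d t≤ post ← k e≢0 = runs (if-nonzero e≢0 d)
  (≤-trans (+-mono-≤ (m≤m*n (1 + cost e) X) (≤-trans t≤ (*-monoˡ-≤ X (m≤m+n (size p) (size q)))))
           (≤-reflexive (sym (*-distribʳ-+ X (1 + cost e) _)))) post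
... | yes e≡0 with runs d t≤ post ← k′ e≡0 = runs (if-zero e≡0 d)
  (≤-trans (+-mono-≤ (m≤m*n (1 + cost e) X) (≤-trans t≤ (*-monoˡ-≤ X (m≤n+m (size q) (size p)))))
           (≤-reflexive (sym (*-distribʳ-+ X (1 + cost e) _)))) post

map-runs : Runs p s X Q → (∀ s′ → Q s′ → R s′) → Runs p s X R
map-runs (runs d t≤ post) Q⇒R = runs d t≤ (Q⇒R _ post)

-- Counts down, so that the bound is evaluated only once.
loop : ℕ → Exp → Program → Program
loop i e p = i ≔ e ⨾ whilenz (var i) (i ≔ var i ⊖ lit 1 ⨾ p)

module _ (i : ℕ) (e : Exp) (p : Program) (s : State) (I : ℕ → State → Set)
         (stable : ∀ {m s v} → I m s → I m (setRegister i v s))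
         (unwritten : writesRegister p i ≡ false)
         (step : ∀ m s′ → Frame (loop i e p) s s′ → m < ⟦ e ⟧ s →
                 register s′ i ≡ m → I (suc m) s′ → Runs p s′ X (I m))
         .{{_ : NonZero X}}
  where

  -- `m` passes are still to come. The counter is decremented before `p` runs, so `p` sees exactly
  -- the indices below the bound. Besides `p`, a pass costs 2 for the test and 4 for the decrement;
  -- the leading 2 is the final, failing test.
  while-runs : ∀ m s′ → Frame (loop i e p) s s′ → m ≤ ⟦ e ⟧ s → register s′ i ≡ m → I m s′ →
               ∃[ s″ ] ∃[ t ] (whilenz (var i) (i ≔ var i ⊖ lit 1 ⨾ p) , s′ ⇓ s″ , t) ×
                 t ≤ 2 + m * (6 + size p * X) × I 0 s″
  while-runs zero s′ fr m≤ i≡ I0 = s′ , _ , while-zero i≡ , ≤-refl , I0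
  while-runs (suc m) s′ fr m< i≡ Im
    with runs {s₁} {t₁} d t₁≤ post ← step m (setRegister i (register s′ i ∸ 1) s′)
           (Frame-trans fr (Frame-seqˡ {i ≔ e} (Frame-assign {e = e} _))) m<
           (trans (update-same (register s′) i _) (cong (_∸ 1) i≡)) (stable Im)
    with s₂ , t₂ , d′ , t₂≤ , I0 ← while-runs m s₁
           (Frame-trans {s′ = setRegister i (register s′ i ∸ 1) s′}
             (Frame-trans fr (Frame-seqˡ {i ≔ e} (Frame-assign {e = e} _)))
             (Frame-seqʳ {i ≔ e} (Frame-while (Frame-seqʳ {i ≔ var i ⊖ lit 1} (⇓⇒Frame d)))))
           (<⇒≤ m<)
           (trans (reg (⇓⇒Frame d) i unwritten) (trans (update-same (register s′) i _) (cong (_∸ 1) i≡)))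
           post
    = s₂ , _ , while-nonzero (λ i≡0 → contradiction (trans (sym i≡) i≡0) λ ()) (seq assign d) d′ , bound , I0
    where
    bound : 2 + (4 + t₁) + t₂ ≤ 2 + suc m * (6 + size p * X)
    bound = ≤-trans (+-mono-≤ (+-monoʳ-≤ 6 t₁≤) t₂≤) (≤-reflexive (lemma (size p * X) (m * (6 + size p * X))))
      where
      lemma : ∀ a b → 6 + a + (2 + b) ≡ 2 + (6 + a + b)
      lemma = solve-∀

  loop-runs : .{{_ : NonZero Y}} → I (⟦ e ⟧ s) s → ⟦ e ⟧ s * X ≤ Y → Runs (loop i e p) s Y (I 0)
  loop-runs {Y = Y} IM MX≤Y
    with s₂ , t₂ , d , t₂≤ , I0 ← while-runs (⟦ e ⟧ s) (setRegister i (⟦ e ⟧ s) s)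
           (Frame-seqˡ (Frame-assign _)) ≤-refl (update-same (register s) i _) (stable IM)
    = runs (seq assign d) bound I0
    where
    M = ⟦ e ⟧ s
    open ≤-Reasoning
    lemma : ∀ M X z → M * (6 + z * X) ≡ M * 6 + z * (M * X)
    lemma = solve-∀
    lemma′ : ∀ c z Y → (c * Y) + (2 * Y + (Y * 6 + z * Y)) ≡ (c + (2 + (6 + z))) * Y
    lemma′ = solve-∀
    bound : 1 + cost e + t₂ ≤ size (loop i e p) * Y
    bound = begin
      1 + cost e + t₂                         ≤⟨ +-monoʳ-≤ (1 + cost e) t₂≤ ⟩
      1 + cost e + (2 + M * (6 + size p * X)) ≡⟨ cong (λ z → 1 + cost e + (2 + z)) (lemma M X (size p)) ⟩
      1 + cost e + (2 + (M * 6 + size p * (M * X)))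
        -- `X` is nonzero, so the number `M` of passes is itself at most `Y`.
        ≤⟨ +-mono-≤ (m≤m*n (1 + cost e) Y) (+-mono-≤ (m≤m*n 2 Y)
             (+-mono-≤ (*-monoˡ-≤ 6 (≤-trans (m≤m*n M X) MX≤Y)) (*-monoʳ-≤ (size p) MX≤Y))) ⟩
      (1 + cost e) * Y + (2 * Y + (Y * 6 + size p * Y)) ≡⟨ lemma′ (1 + cost e) (size p) Y ⟩
      (1 + cost e + (2 + (6 + size p))) * Y   ∎

-- The algorithm

rN rK rI rJ rAcc rSources rCandidates rPower rMask rRest rSize rAnswer : ℕ
rN          = 0
rK          = 1
rI          = 2
rJ          = 3
rAcc        = 4
rSources    = 5
rCandidates = 6
rPower      = 7
rMask       = 8
rRest       = 9
rSize       = 10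
rAnswer     = 11

aMatrix aRow aDeg aForced aWeight aSet aCover : ℕ
aMatrix = 0
aRow    = 1
aDeg    = 2
aForced = 3
aWeight = 4
aSet    = 5
aCover  = 6

sumOf : Exp → Program
sumOf e = rAcc ≔ lit 0 ⨾ loop rJ (var rN) (rAcc ≔ var rAcc ⊕ e)

tabulateSums : ℕ → Exp → Program
tabulateSums a e = loop rI (var rN) (sumOf e ⨾ a [ var rI ]≔ var rAcc)

sumOf-runs : (g : ℕ → ℕ) → register s rN ≡ n →
             (∀ s′ j → Frame (sumOf e) s s′ → register s′ rJ ≡ j → j < n → ⟦ e ⟧ s′ ≡ g j) →
             .{{_ : NonZero Y}} → n ≤ Y →
             Runs (sumOf e) s Y (λ s′ → register s′ rAcc ≡ ∑ n g)
sumOf-runs {s} {e = e} {Y = Y} g refl e≡g n≤Y =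
  seq-runs {Q = λ s′ → register s′ rAcc ≡ 0} (assign-runs refl) λ s₁ fr₁ acc≡0 →
  let n≡ = reg fr₁ rN refl in
  map-runs (loop-runs {X = 1} rJ (var rN) (rAcc ≔ var rAcc ⊕ e) s₁
    -- The loop counts down, so the terms still missing from the accumulator form the initial
    -- segment `∑ m g`.
    (λ m s′ → register s′ rAcc + ∑ m g ≡ ∑ (register s rN) g) id refl
    (λ m s′ fr m<n j≡m I → assign-runs (trans
      (cong (λ z → register s′ rAcc + z + ∑ m g)
        (e≡g s′ m (Frame-trans (Frame-seqˡ fr₁) (Frame-seqʳ fr)) j≡m (≤-trans m<n (≤-reflexive n≡))))
      (trans (+-assoc (register s′ rAcc) (g m) (∑ m g))
        (trans (cong (register s′ rAcc +_) (+-comm (g m) (∑ m g))) I))))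
    (trans (cong (_+ ∑ (register s₁ rN) g) acc≡0) (cong (λ m → ∑ m g) n≡))
    (≤-trans (≤-reflexive (trans (*-identityʳ _) n≡)) n≤Y)) λ _ I → trans (sym (+-identityʳ _)) I

Holds : ℕ → ℕ → (ℕ → ℕ) → State → Set
Holds n a f s = ∀ i → i < n → array s a i ≡ f i

Holds-frame : ∀ {f} → Frame p s s′ → writesArray p a ≡ false → Holds n a f s → Holds n a f s′
Holds-frame fr w h i i<n = trans (cong-app (arr fr _ w) i) (h i i<n)

setArray-same : ∀ a i v s → array (setArray a i v s) a i ≡ v
setArray-same a i v s rewrite update-same (array s) a (array s a [ i ↦ v ]) = update-same (array s a) i v

setArray-other : ∀ a {i i′} v s → i′ ≢ i → array (setArray a i v s) a i′ ≡ array s a i′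
setArray-other a {i} v s i′≢i rewrite update-same (array s) a (array s a [ i ↦ v ]) = update-other (array s a) v i′≢i

tabulateSums-runs : (g : ℕ → ℕ → ℕ) → register s rN ≡ n →
  (∀ s′ i j → Frame (tabulateSums a e) s s′ → register s′ rI ≡ i → register s′ rJ ≡ j → i < n → j < n →
     ⟦ e ⟧ s′ ≡ g i j) →
  .{{_ : NonZero n}} → .{{_ : NonZero Y}} → n * n ≤ Y →
  Runs (tabulateSums a e) s Y (Holds n a (λ i → ∑ n (g i)))
tabulateSums-runs {s} {n} {a} {e} {Y = Y} g n≡ e≡g n*n≤Y =
  map-runs (loop-runs {X = n} rI (var rN) (sumOf e ⨾ a [ var rI ]≔ var rAcc) s
    (λ m s′ → ∀ i → m ≤ i → i < n → array s′ a i ≡ ∑ n (g i)) id refl step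
    (λ i n≤i i<n → contradiction i<n (≤⇒≯ (subst (_≤ i) n≡ n≤i)))
    (≤-trans (≤-reflexive (cong (_* n) n≡)) n*n≤Y)) λ _ h i i<n → h i z≤n i<n
  where
  step : ∀ m s′ → Frame (tabulateSums a e) s s′ → m < register s rN → register s′ rI ≡ m →
         (∀ i → suc m ≤ i → i < n → array s′ a i ≡ ∑ n (g i)) →
         Runs (sumOf e ⨾ a [ var rI ]≔ var rAcc) s′ n (λ s″ → ∀ i → m ≤ i → i < n → array s″ a i ≡ ∑ n (g i))
  step m s′ fr m<n i≡m I = seq-runs
    (sumOf-runs (g m) (trans (reg fr rN refl) n≡)
      (λ s₁ j fr₁ j≡ j<n → e≡g s₁ m j
         (Frame-trans fr (Frame-seqʳ {rI ≔ var rN} (Frame-while (Frame-seqʳ {rI ≔ var rI ⊖ lit 1} (Frame-seqˡ fr₁)))))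
         (trans (reg fr₁ rI refl) i≡m) j≡ (subst (m <_) n≡ m<n) j<n) ≤-refl)
    λ s₁ fr₁ acc≡ → store-runs (stored s₁ (trans (reg fr₁ rI refl) i≡m) acc≡ (cong-app (arr fr₁ a refl)))
    where
    stored : ∀ s₁ → register s₁ rI ≡ m → register s₁ rAcc ≡ ∑ n (g m) → (∀ i → array s₁ a i ≡ array s′ a i) →
             ∀ i → m ≤ i → i < n → array (setArray a (register s₁ rI) (register s₁ rAcc) s₁) a i ≡ ∑ n (g i)
    stored s₁ refl acc≡ arr≡ i m≤i i<n with i ≟ m
    ... | yes refl = trans (setArray-same a i _ s₁) acc≡
    ... | no i≢m = trans (setArray-other a _ s₁ i≢m) (trans (arr≡ i) (I i (≤∧≢⇒< m≤i (≢-sym i≢m)) i<n))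

-- `aRow` stores the offset `n * u` of row `u`, as the machine cannot multiply.
entry : Exp → Exp → Exp
entry u w = aMatrix [ aRow [ u ] ⊕ w ]

countSources : Program
countSources =
  -- A sum of `n` copies of the row number is the offset of the row.
  tabulateSums aRow (var rI) ⨾
  tabulateSums aDeg (entry (var rJ) (var rI)) ⨾
  sumOf (lit 1 ⊖ aDeg [ var rJ ]) ⨾
  rSources ≔ var rAcc

countCandidates : Program
countCandidates =
  tabulateSums aForced (lit 1 ⊖ (aDeg [ var rJ ] ⊖ lit 1 ⊕ (lit 1 ⊖ aDeg [ var rJ ])
                                  ⊕ (lit 1 ⊖ entry (var rI) (var rJ)))) ⨾
  sumOf (lit 1 ⊖ aForced [ var rJ ]) ⨾
  rCandidates ≔ var rAcc

-- The weights are prefix counts and need the vertices in increasing order, whereas the loop counter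
-- descends; `rRest` therefore counts upwards on its own.
weightStep : Program
weightStep =
  aWeight [ var rRest ]≔ var rPower ⨾
  ifnz (aForced [ var rRest ]) skip (rPower ≔ var rPower ⊕ var rPower) ⨾
  rRest ≔ var rRest ⊕ lit 1

computeWeights : Program
computeWeights = rPower ≔ lit 1 ⨾ rRest ≔ lit 0 ⨾ loop rI (var rN) weightStep

-- Greedy conversion to binary from the most significant digit, which is the order in which the loop
-- counter runs.
decodeStep : Program
decodeStep =
  aSet [ var rI ]≔ lit 1 ⊖ (aWeight [ var rI ] ⊖ var rRest) ⨾
  ifnz (aSet [ var rI ]) (rRest ≔ var rRest ⊖ aWeight [ var rI ]) skip

decode : Program
decode = rRest ≔ var rMask ⨾ loop rI (var rN) decodeStep

check : Program
check =
  sumOf (aSet [ var rJ ]) ⨾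
  rSize ≔ var rAcc ⨾
  tabulateSums aCover (lit 1 ⊖ (lit 1 ⊖ entry (var rJ) (var rI) ⊕ aSet [ var rJ ])) ⨾
  sumOf (lit 1 ⊖ aCover [ var rJ ]) ⨾
  -- The sum is zero exactly if both truncated differences are: the set has at least `k` vertices
  -- and leaves at most one vertex uncovered.
  ifnz ((var rK ⊖ var rSize) ⊕ (var rAcc ⊖ lit 1)) skip (rAnswer ≔ lit 1)

enumerate : Program
enumerate =
  rAnswer ≔ lit 0 ⨾
  loop rMask (var rPower) (decode ⨾ check) ⨾
  rN ≔ var rAnswer

decideLeaves : Program
decideLeaves =
  countSources ⨾ countCandidates ⨾ computeWeights ⨾
  ifnz ((var rSources ⊖ lit 1) ⊕ (lit 1 ⊖ var rSources))
    (rN ≔ lit 0)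
    (ifnz ((var rK ⊕ var rK ⊕ var rK) ⊖ var rCandidates)
      enumerate
      (rN ≔ lit 1))

-- Correctness and running time of the algorithm

module Correctness {n k : ℕ} (D : Digraph n) .{{_ : NonZero n}} where

  Deg Forced Weight : State → Set
  Deg    = Holds n aDeg (deg D)
  Forced = Holds n aForced (forced D)
  Weight = Holds n aWeight (weight D)

  record Loaded (s : State) : Set where
    field
      n≡      : register s rN ≡ n
      k≡      : register s rK ≡ k
      matrix≡ : array s aMatrix ≡ matrix D

  open Loaded

  record Ready (s : State) : Set where
    field
      loaded  : Loaded s
      rows    : Holds n aRow (n *_) s

  open Ready

  Loaded-frame : ∀ {p s s′} → Frame p s s′ → writesRegister p rN ≡ false → writesRegister p rK ≡ false →
                 writesArray p aMatrix ≡ false → Loaded s → Loaded s′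
  Loaded-frame fr w₀ w₁ w₂ l = record
    { n≡ = trans (reg fr rN w₀) (n≡ l) ; k≡ = trans (reg fr rK w₁) (k≡ l)
    ; matrix≡ = trans (arr fr aMatrix w₂) (matrix≡ l) }

  Ready-frame : ∀ {p s s′} → Frame p s s′ → writesRegister p rN ≡ false → writesRegister p rK ≡ false →
                writesArray p aMatrix ≡ false → writesArray p aRow ≡ false → Ready s → Ready s′
  Ready-frame fr w₀ w₁ w₂ w₃ r = record
    { loaded = Loaded-frame fr w₀ w₁ w₂ (loaded r) ; rows = Holds-frame fr w₃ (rows r) }

  entry≡ : ∀ {s} → Ready s → ∀ x y {u w} → register s x ≡ u → register s y ≡ w → u < n →
           ⟦ entry (var x) (var y) ⟧ s ≡ adjacency D u w
  entry≡ r x y refl refl u<n = trans (cong-app (matrix≡ (loaded r)) _) (cong (λ z → matrix D (z + _)) (rows r _ u<n))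

  private instance
    n*n-nonZero : NonZero (n * n)
    n*n-nonZero = m*n≢0 n n

  Good-cong : ∀ {L L′} → (∀ v → v < n → L′ v ≡ L v) → Good D k L → Good D k L′
  Good-cong L′≡L good = record
    { size≥k = ≤-trans (size≥k good) (≤-reflexive (sym (∑-cong n L′≡L)))
    ; covered = ≤-trans (≤-reflexive (∑-cong n λ w _ → cong (1 ∸_)
        (∑-cong n λ u u<n → cong (λ l → 1 ∸ (1 ∸ adjacency D u w + l)) (L′≡L u u<n)))) (covered good)
    ; binary = λ v v<n → ≤-trans (≤-reflexive (L′≡L v v<n)) (binary good v v<n)
    }

  Checked : (ℕ → ℕ) → ℕ → State → Set
  Checked L answer s = (Good D k L × register s rAnswer ≡ 1) ⊎ (¬ Good D k L × register s rAnswer ≡ answer)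

  module _ {Y : ℕ} .{{_ : NonZero Y}} (n*n≤Y : n * n ≤ Y) where

    private
      n≤Y : n ≤ Y
      n≤Y = ≤-trans (m≤m*n n n) n*n≤Y

    countSources-runs : ∀ {s} → Loaded s →
      Runs countSources s Y (λ s′ → Ready s′ × Deg s′ × register s′ rSources ≡ sources D)
    countSources-runs {s} l =
      seq-runs (tabulateSums-runs (λ i _ → i) (n≡ l) (λ s′ i j fr i≡ _ _ _ → i≡) n*n≤Y) λ s₁ fr₁ rows₁ →
      let r₁ : Ready s₁
          r₁ = record { loaded = Loaded-frame fr₁ refl refl refl l
                      ; rows = λ i i<n → trans (rows₁ i i<n) (∑-const n i) } in
      seq-runs (tabulateSums-runs (λ w u → adjacency D u w) (n≡ (loaded r₁))
        (λ s′ w u fr i≡ j≡ _ u<n → entry≡ (Ready-frame fr refl refl refl refl r₁) rJ rI j≡ i≡ u<n) n*n≤Y) λ s₂ fr₂ deg₂ →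
      let r₂ = Ready-frame fr₂ refl refl refl refl r₁ in
      seq-runs (sumOf-runs (λ w → 1 ∸ deg D w) (n≡ (loaded r₂))
        (λ { s′ j fr refl j<n → cong (1 ∸_) (Holds-frame fr refl deg₂ _ j<n) }) n≤Y) λ s₃ fr₃ acc≡ →
      assign-runs (Ready-frame {rSources ≔ var rAcc} (Frame-assign _) refl refl refl refl
                     (Ready-frame fr₃ refl refl refl refl r₂) ,
                   Holds-frame fr₃ refl deg₂ , acc≡)

    countCandidates-runs : ∀ {s} → Ready s → Deg s →
      Runs countCandidates s Y (λ s′ → Forced s′ × register s′ rCandidates ≡ candidates D)
    countCandidates-runs {s} r deg≡ =
      seq-runs (tabulateSums-runs (onlyParent D) (n≡ (loaded r))
        (λ { s′ u w fr refl refl u<n w<n → cong₂ (λ d a → 1 ∸ (d ∸ 1 + (1 ∸ d) + (1 ∸ a)))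
           (Holds-frame fr refl deg≡ _ w<n)
           (entry≡ (Ready-frame fr refl refl refl refl r) rI rJ refl refl u<n) }) n*n≤Y) λ s₁ fr₁ forced≡ →
      seq-runs (sumOf-runs (λ v → 1 ∸ forced D v) (n≡ (loaded (Ready-frame fr₁ refl refl refl refl r)))
        (λ { s′ j fr refl j<n → cong (1 ∸_) (Holds-frame fr refl forced≡ _ j<n) }) n≤Y) λ s₂ fr₂ acc≡ →
      assign-runs (Holds-frame fr₂ refl forced≡ , acc≡)

    computeWeights-runs : ∀ {s} → register s rN ≡ n → Forced s →
      Runs computeWeights s Y (λ s′ → Weight s′ × register s′ rPower ≡ 2 ^ candidates D)
    computeWeights-runs {s} n≡ forced≡ =
      seq-runs {Q = λ s′ → register s′ rPower ≡ 1} (assign-runs refl) λ s₁ fr₁ power≡ →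
      seq-runs {Q = λ s′ → register s′ rRest ≡ 0} (assign-runs refl) λ s₂ fr₂ rest≡ →
      let n≡₂ = trans (reg fr₂ rN refl) (trans (reg fr₁ rN refl) n≡)
          forced₂ = Holds-frame fr₂ refl (Holds-frame fr₁ refl forced≡)
      in map-runs (loop-runs {X = 1} rI (var rN) _ s₂ I id refl
        (λ m s′ fr m< _ Im → step m s′ (Holds-frame fr refl forced₂) (≤-trans m< (≤-reflexive n≡₂)) Im)
        (subst (λ m → Filled (n ∸ m) s₂) (sym n≡₂)
          (subst (λ v → Filled v s₂) (sym (n∸n≡0 n)) (rest≡ , trans (reg fr₂ rPower refl) power≡ , λ _ ())))
        (≤-trans (≤-reflexive (trans (*-identityʳ _) n≡₂)) n≤Y)) λ { s′ (_ , power≡ , weight≡) → weight≡ , power≡ }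
      where
      Filled : ℕ → State → Set
      Filled v s = register s rRest ≡ v × register s rPower ≡ weight D v × (∀ i → i < v → array s aWeight i ≡ weight D i)

      -- With `m` passes left, the first `n ∸ m` vertices have their weights.
      I : ℕ → State → Set
      I m = Filled (n ∸ m)

      step-at : ∀ v s → v < n → Forced s → Filled v s → Runs weightStep s 1 (Filled (suc v))
      step-at v s v<n forced≡ (refl , power≡ , weight≡) = seq-runs (store-runs {Q = λ s′ → s′ ≡ setArray aWeight v (register s rPower) s} refl)
        λ { s₁ fr₁ refl → seq-runs {Q = λ s′ → register s′ rPower ≡ weight D (suc v)}
          (if-runs
            (λ ≢0 → skip-runs (trans power≡ (cong (2 ^_) (sym (trans
              (cong (c +_) (≢0⇒1∸≡0 (subst (_≢ 0) (forced≡ v v<n) ≢0))) (+-identityʳ c))))))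
            (λ ≡0 → assign-runs (trans (cong₂ _+_ power≡ (trans power≡ (sym (+-identityʳ _)))) (cong (2 ^_)
              (trans (+-comm 1 c) (cong (λ f → c + (1 ∸ f)) (sym (trans (sym (forced≡ v v<n)) ≡0))))))))
          λ s₂ fr₂ power≡₂ → assign-runs
            (trans (cong (_+ 1) (reg fr₂ rRest refl)) (+-comm v 1) , power≡₂ ,
             λ i i<1+v → trans (cong-app (arr fr₂ aWeight refl) i) (stored i i<1+v)) }
        where
        c = ∑ v (λ u → 1 ∸ forced D u)
        stored : ∀ i → i < suc v → (array s aWeight [ v ↦ register s rPower ]) i ≡ weight D i
        stored i i<1+v with m<1+n⇒m<n∨m≡n i<1+v
        ... | inj₁ i<v  = trans (update-other (array s aWeight) _ (<⇒≢ i<v)) (weight≡ i i<v)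
        ... | inj₂ refl = trans (update-same (array s aWeight) v _) power≡

      step : ∀ m s → Forced s → m < n → I (suc m) s → Runs weightStep s 1 (I m)
      step m s forced≡ m<n Im = subst (λ v → Runs weightStep s 1 (Filled v)) (sym (∸-suc′ m<n))
        (step-at (n ∸ suc m) s (subst (_≤ n) (∸-suc′ m<n) (m∸n≤m n m)) forced≡ Im)
        where
        ∸-suc′ : m < n → n ∸ m ≡ suc (n ∸ suc m)
        ∸-suc′ m<n = +-∸-assoc 1 m<n

    -- The decoded array is identified only for a mask that is the code of a set of unforced
    -- vertices. For other masks it suffices that the entries are at most 1, since `check` tests the
    -- rest of what makes a set good.
    decode-runs : ∀ {s} → register s rN ≡ n → Weight s →
      Runs decode s Y (λ s′ → (∀ v → v < n → array s′ aSet v ≤ 1) ×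
        (∀ S → (∀ v → v < n → S v ≤ 1) → Unforced D S → code D n S ≡ register s rMask → Holds n aSet S s′))
    decode-runs {s} n≡ weight≡ =
      seq-runs {Q = λ s′ → register s′ rRest ≡ register s rMask} (assign-runs refl) λ s₁ fr₁ rest≡ →
      let n≡₁ = trans (reg fr₁ rN refl) n≡
          weight₁ = Holds-frame fr₁ refl weight≡
      in map-runs (loop-runs {X = 1} rI (var rN) decodeStep s₁ I id refl
        (λ { m s′ fr m< i≡ Im → step m s′ (Holds-frame fr refl weight₁) (≤-trans m< (≤-reflexive n≡₁)) i≡ Im })
        (subst (λ m → I m s₁) (sym n≡₁)
          ((λ v n≤v v<n → contradiction v<n (≤⇒≯ n≤v)) ,
           λ S _ _ code≡ → trans rest≡ (sym code≡) , λ v n≤v v<n → contradiction v<n (≤⇒≯ n≤v)))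
        (≤-trans (≤-reflexive (trans (*-identityʳ _) n≡₁)) n≤Y))
        λ s′ (bin , dec) → (λ v v<n → bin v z≤n v<n) ,
          λ S S≤1 unf code≡ v v<n → proj₂ (dec S S≤1 unf code≡) v z≤n v<n
      where
      I : ℕ → State → Set
      I m s′ = (∀ v → m ≤ v → v < n → array s′ aSet v ≤ 1) ×
        (∀ S → (∀ v → v < n → S v ≤ 1) → Unforced D S → code D n S ≡ register s rMask →
           register s′ rRest ≡ code D m S × (∀ v → m ≤ v → v < n → array s′ aSet v ≡ S v))

      step : ∀ m s → Weight s → m < n → register s rI ≡ m → I (suc m) s → Runs decodeStep s 1 (I m)
      step m s weight≡ m<n refl (bin , dec) = seq-runs
        (store-runs {Q = λ s′ → s′ ≡ setArray aSet m bit s} refl) λ { s₁ fr₁ refl →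
        if-runs
          (λ ≢0 → assign-runs (bin′ , λ S S≤1 unf code≡ →
            let rest≡ , set≡ = dec S S≤1 unf code≡
                bit≡ = trans (cong₂ (λ w r → 1 ∸ (w ∸ r)) (weight≡ m m<n) rest≡) (decode-bit D S≤1 unf m m<n)
                S≡1 = ≤-antisym (S≤1 m m<n) (n≢0⇒n>0 (subst (_≢ 0) (trans set-m bit≡) ≢0))
            in trans (cong₂ _∸_ rest≡ (weight≡ m m<n))
                 (trans (cong (λ b → code D m S + b * weight D m ∸ weight D m) S≡1)
                   (trans (cong (λ w → code D m S + w ∸ weight D m) (*-identityˡ (weight D m)))
                     (m+n∸n≡m (code D m S) (weight D m)))) ,
               set′ S bit≡ set≡))
          (λ ≡0 → skip-runs (bin′ , λ S S≤1 unf code≡ →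
            let rest≡ , set≡ = dec S S≤1 unf code≡
                bit≡ = trans (cong₂ (λ w r → 1 ∸ (w ∸ r)) (weight≡ m m<n) rest≡) (decode-bit D S≤1 unf m m<n)
                S≡0 = trans (sym bit≡) (trans (sym set-m) ≡0)
            in trans rest≡ (trans (cong (λ b → code D m S + b * weight D m) S≡0) (+-identityʳ _)) ,
               set′ S bit≡ set≡)) }
        where
        bit = 1 ∸ (array s aWeight m ∸ register s rRest)
        set-m : (array s aSet [ m ↦ bit ]) m ≡ bit
        set-m = update-same (array s aSet) m bit
        set-other : ∀ {v} → v ≢ m → (array s aSet [ m ↦ bit ]) v ≡ array s aSet v
        set-other v≢m = update-other (array s aSet) bit v≢m
        bin′ : ∀ v → m ≤ v → v < n → (array s aSet [ m ↦ bit ]) v ≤ 1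
        bin′ v m≤v v<n with v ≟ m
        ... | yes refl = ≤-trans (≤-reflexive set-m) (m∸n≤m 1 (array s aWeight m ∸ register s rRest))
        ... | no v≢m = ≤-trans (≤-reflexive (set-other v≢m)) (bin v (≤∧≢⇒< m≤v (≢-sym v≢m)) v<n)
        set′ : ∀ S → bit ≡ S m → (∀ v → suc m ≤ v → v < n → array s aSet v ≡ S v) →
               ∀ v → m ≤ v → v < n → (array s aSet [ m ↦ bit ]) v ≡ S v
        set′ S bit≡ set≡ v m≤v v<n with v ≟ m
        ... | yes refl = trans set-m bit≡
        ... | no v≢m = trans (set-other v≢m) (set≡ v (≤∧≢⇒< m≤v (≢-sym v≢m)) v<n)

    check-runs : ∀ {s} → Ready s → (∀ v → v < n → array s aSet v ≤ 1) →
      Runs check s Y (Checked (array s aSet) (register s rAnswer))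
    check-runs {s} r bin =
      seq-runs (sumOf-runs L (n≡ (loaded r)) (λ { s′ j fr refl _ → cong-app (arr fr aSet refl) _ }) n≤Y) λ s₁ fr₁ size≡ →
      seq-runs {Q = λ s′ → register s′ rSize ≡ ∑ n L} (assign-runs size≡) λ s₂ fr₂ size≡ →
      let r₂ : Ready s₂
          r₂ = Ready-frame fr₂ refl refl refl refl (Ready-frame fr₁ refl refl refl refl r)
          set₂ : array s₂ aSet ≡ L
          set₂ = trans (arr fr₂ aSet refl) (arr fr₁ aSet refl)
      in seq-runs (tabulateSums-runs (λ w u → 1 ∸ (1 ∸ adjacency D u w + L u)) (n≡ (loaded r₂))
        (λ { s′ w u fr refl refl _ u<n → cong₂ (λ a l → 1 ∸ (1 ∸ a + l))
           (entry≡ (Ready-frame fr refl refl refl refl r₂) rJ rI refl refl u<n)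
           (cong-app (trans (arr fr aSet refl) set₂) _) }) n*n≤Y) λ s₃ fr₃ cover≡ →
      let r₃ : Ready s₃
          r₃ = Ready-frame fr₃ refl refl refl refl r₂ in
      seq-runs (sumOf-runs (λ w → 1 ∸ cover D L w) (n≡ (loaded r₃))
        (λ { s′ j fr refl j<n → cong (1 ∸_) (Holds-frame fr refl cover≡ _ j<n) }) n≤Y) λ s₄ fr₄ acc≡ →
      let answer≡ = trans (reg fr₄ rAnswer refl) (trans (reg fr₃ rAnswer refl)
                      (trans (reg fr₂ rAnswer refl) (reg fr₁ rAnswer refl)))
          test≡ : ⟦ (var rK ⊖ var rSize) ⊕ (var rAcc ⊖ lit 1) ⟧ s₄ ≡ (k ∸ ∑ n L) + (uncovered D L ∸ 1)
          test≡ = cong₂ _+_ (cong₂ _∸_ (k≡ (loaded (Ready-frame fr₄ refl refl refl refl r₃)))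
                    (trans (reg fr₄ rSize refl) (trans (reg fr₃ rSize refl) size≡))) (cong (_∸ 1) acc≡)
      in if-runs
        (λ ≢0 → skip-runs (inj₂ ((λ good → ≢0 (trans test≡
          (cong₂ _+_ (m≤n⇒m∸n≡0 (size≥k good)) (m≤n⇒m∸n≡0 (covered good))))) , answer≡)))
        (λ ≡0 → let ≡0′ = trans (sym test≡) ≡0 in assign-runs (inj₁ (record
          { size≥k = m∸n≡0⇒m≤n (m+n≡0⇒m≡0 _ ≡0′)
          ; covered = m∸n≡0⇒m≤n (m+n≡0⇒n≡0 (k ∸ ∑ n L) ≡0′)
          ; binary = bin } , refl)))
      where
      L = array s aSet

  Decided : Set → State → Set
  Decided P s = (P × register s 0 ≡ 1) ⊎ (¬ P × register s 0 ≡ 0)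

  enumerate-runs : ∀ {s Y} .{{_ : NonZero Y}} → Ready s → Weight s → register s rPower ≡ 2 ^ candidates D →
    sources D ≡ 1 → 2 ^ candidates D * (n * n) ≤ Y → Runs enumerate s Y (Decided (∃[ L ] Good D k L))
  enumerate-runs {s} {Y} r weight≡ power≡ sources≡1 ≤Y =
    seq-runs {Q = λ s′ → register s′ rAnswer ≡ 0} (assign-runs refl) λ s₁ fr₁ answer≡ →
    let r₁ : Ready s₁
        r₁ = Ready-frame fr₁ refl refl refl refl r
        weight₁ = Holds-frame fr₁ refl weight≡
        power₁ = trans (reg fr₁ rPower refl) power≡
    in seq-runs (loop-runs {X = n * n} rMask (var rPower) (decode ⨾ check) s₁ I id refl
      (λ m s′ fr _ mask≡ Im → step m s′ (Ready-frame fr refl refl refl refl r₁) (Holds-frame fr refl weight₁) mask≡ Im)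
      -- No mask has been tried yet, and none will be missed: a good set avoids the forced vertices,
      -- so its code lies below `2 ^ candidates D`.
      (inj₂ (answer≡ , λ L good ≤code → <⇒≱
        (code<weight D (binary good) (good⇒¬forced D sources≡1 good) n ≤-refl)
        (subst (_≤ code D n L) power₁ ≤code)))
      (≤-trans (≤-reflexive (cong (_* (n * n)) power₁)) ≤Y))
    λ { s₂ fr₂ (inj₁ (answer≡1 , good)) → assign-runs (inj₁ (good , answer≡1))
      ; s₂ fr₂ (inj₂ (answer≡0 , ¬good)) → assign-runs (inj₂ ((λ { (L , good) → ¬good L good z≤n }) , answer≡0)) }
    where
    I : ℕ → State → Set
    I m s = (register s rAnswer ≡ 1 × ∃[ L ] Good D k L) ⊎
            (register s rAnswer ≡ 0 × (∀ L → Good D k L → m ≤ code D n L → ⊥))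

    step : ∀ m s → Ready s → Weight s → register s rMask ≡ m → I (suc m) s → Runs (decode ⨾ check) s (n * n) (I m)
    step m s r weight≡ refl Im =
      seq-runs (decode-runs ≤-refl (n≡ (loaded r)) weight≡) λ s₁ fr₁ (bin , dec) →
      map-runs (check-runs ≤-refl (Ready-frame fr₁ refl refl refl refl r) bin) λ
        { s₂ (inj₁ (good , answer≡1)) → inj₁ (answer≡1 , _ , good)
        ; s₂ (inj₂ (¬good , answer≡)) → unchanged s₂ (trans answer≡ (reg fr₁ rAnswer refl)) (λ L good code≡ →
            -- The array agrees with `L` only below `n`, which is all that `Good` looks at.
            ¬good (Good-cong (dec L (binary good) (good⇒¬forced D sources≡1 good) code≡) good)) Im }
      where
      unchanged : ∀ s₂ → register s₂ rAnswer ≡ register s rAnswer →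
                  (∀ L → Good D k L → code D n L ≡ m → ⊥) → I (suc m) s → I m s₂
      unchanged s₂ answer≡ _ (inj₁ (answer≡1 , good)) = inj₁ (trans answer≡ answer≡1 , good)
      unchanged s₂ answer≡ ¬m (inj₂ (answer≡0 , ¬good)) = inj₂ (trans answer≡ answer≡0 , λ L good m≤code →
        Sum.[ (λ m<code → ¬good L good m<code) , (λ m≡code → ¬m L good (sym m≡code)) ] (m≤n⇒m<n∨m≡n m≤code))

decideLeaves-runs : ∀ {n k} .{{_ : NonZero n}} (D : Digraph n) → Acyclic D →
  Runs decideLeaves (input D k) (2 ^ (3 * k) * (n * n)) (Correctness.Decided {n} {k} D (DMLOB D k))
decideLeaves-runs {n} {k} D acyclic =
  seq-runs (countSources-runs n*n≤Y record { n≡ = refl ; k≡ = refl ; matrix≡ = refl })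
  λ s₁ fr₁ (r₁ , deg₁ , sources₁) →
  seq-runs (countCandidates-runs n*n≤Y r₁ deg₁) λ s₂ fr₂ (forced₂ , candidates₂) →
  let r₂ = Ready-frame fr₂ refl refl refl refl r₁ in
  seq-runs (computeWeights-runs n*n≤Y (n≡ (loaded r₂)) forced₂) λ s₃ fr₃ (weight₃ , power₃) →
  let r₃ = Ready-frame fr₃ refl refl refl refl r₂
      sources₃ = trans (reg fr₃ rSources refl) (trans (reg fr₂ rSources refl) sources₁)
      candidates₃ = trans (reg fr₃ rCandidates refl) candidates₂
      k₃ = k≡ (loaded r₃)
      sourceTest : ⟦ (var rSources ⊖ lit 1) ⊕ (lit 1 ⊖ var rSources) ⟧ s₃ ≡ (sources D ∸ 1) + (1 ∸ sources D)
      sourceTest = cong (λ x → (x ∸ 1) + (1 ∸ x)) sources₃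
      candidateTest : ⟦ (var rK ⊕ var rK ⊕ var rK) ⊖ var rCandidates ⟧ s₃ ≡ 3 * k ∸ candidates D
      candidateTest = cong₂ _∸_ (trans (cong (λ x → x + x + x) k₃) (thrice k)) candidates₃
  in if-runs
    (λ ≢0 → assign-runs (inj₂ ((λ branching → ≢0 (trans sourceTest
      (cong (λ x → (x ∸ 1) + (1 ∸ x)) (outBranching⇒one-source acyclic o branching)))) , refl)))
    λ ≡0 →
      let sourceTest≡0 = trans (sym sourceTest) ≡0
          sources≡1 = ≤-antisym (m∸n≡0⇒m≤n (m+n≡0⇒m≡0 _ sourceTest≡0))
                                (m∸n≡0⇒m≤n (m+n≡0⇒n≡0 (sources D ∸ 1) sourceTest≡0))
      in if-runs
        -- This branch is taken only if `candidates D < 3 * k`, which keeps the number of masks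
        -- within `2 ^ (3 * k)`.
        (λ ≢0 → map-runs
          (enumerate-runs r₃ weight₃ power₃ sources≡1
            (*-monoˡ-≤ (n * n) (^-monoʳ-≤ 2 (<⇒≤ (m∸n≢0⇒n<m {3 * k} {candidates D} (subst (_≢ 0) candidateTest ≢0))))))
          λ { s (inj₁ ((L , good) , ≡1)) → inj₁ (good⇒outBranching acyclic sources≡1 good , ≡1)
            ; s (inj₂ (¬good , ≡0)) → inj₂ (¬good ∘ outBranching⇒good acyclic o , ≡0) })
        λ ≡0 → assign-runs (inj₁ (good⇒outBranching acyclic sources≡1
          (proj₂ (many-candidates⇒good D sources≡1 k (m∸n≡0⇒m≤n (trans (sym candidateTest) ≡0)))) , refl))
  where
  open Correctness {n} {k} D
  open Loaded
  open Ready
  instance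
    2^3k-nonZero : NonZero (2 ^ (3 * k))
    2^3k-nonZero = m^n≢0 2 (3 * k)
    Y-nonZero : NonZero (2 ^ (3 * k) * (n * n))
    Y-nonZero = m*n≢0 (2 ^ (3 * k)) (n * n) {{2^3k-nonZero}} {{m*n≢0 n n}}
  n*n≤Y : n * n ≤ 2 ^ (3 * k) * (n * n)
  n*n≤Y = m≤n*m (n * n) (2 ^ (3 * k))
  o : Fin n
  o = fromℕ< (>-nonZero⁻¹ n)
  thrice : ∀ k → k + k + k ≡ 3 * k
  thrice k = trans (+-assoc k k k) (cong (λ x → k + (k + x)) (sym (+-identityʳ k)))

-- The time bound

-- For `k ≥ 2` the base 2 may be replaced by `k`. For `k = 1` the power on the right is 1, and all
-- of `2 ^ 3` has to come from the factor 8.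
2^3k≤8*k^ck : ∀ k c → .{{NonZero k}} → 3 ≤ c → 2 ^ (3 * k) ≤ 8 * k ^ (c * k)
2^3k≤8*k^ck 1 c 3≤c = ≤-reflexive (cong (8 *_) (sym (^-zeroˡ (c * 1))))
2^3k≤8*k^ck k@(suc (suc _)) c 3≤c = begin
  2 ^ (3 * k)        ≤⟨ ^-monoʳ-≤ 2 (*-monoˡ-≤ k 3≤c) ⟩
  2 ^ (c * k)        ≤⟨ ^-monoˡ-≤ (c * k) (s≤s (s≤s z≤n)) ⟩
  k ^ (c * k)        ≤⟨ m≤n*m _ 8 ⟩
  8 * k ^ (c * k)    ∎
  where open ≤-Reasoning

time-bound : ∀ n k a c → .{{_ : NonZero n}} → .{{_ : NonZero k}} → 8 * a ≤ c → 3 ≤ c →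
             a * (2 ^ (3 * k) * (n * n)) ≤ c * k ^ (c * k) * n ^ c
time-bound n k a c 8a≤c 3≤c = begin
  a * (2 ^ (3 * k) * (n * n))          ≤⟨ *-monoʳ-≤ a (*-monoˡ-≤ (n * n) (2^3k≤8*k^ck k c 3≤c)) ⟩
  a * (8 * k ^ (c * k) * (n * n))      ≡⟨ rearrange a (k ^ (c * k)) n ⟩
  8 * a * k ^ (c * k) * n ^ 2          ≤⟨ *-mono-≤ (*-monoˡ-≤ (k ^ (c * k)) 8a≤c) (^-monoʳ-≤ n (<⇒≤ 3≤c)) ⟩
  c * k ^ (c * k) * n ^ c              ∎
  where
  open ≤-Reasoning
  rearrange : ∀ a x n → a * (8 * x * (n * n)) ≡ 8 * a * x * n ^ 2
  rearrange a x n = trans (sym (*-assoc a (8 * x) (n * n)))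
    (cong₂ _*_ (trans (sym (*-assoc a 8 x)) (cong (_* x) (*-comm a 8))) (cong (n *_) (sym (*-identityʳ n))))

corollary1 : ∃[ p ] ∃[ c ] (∀ (n k : ℕ) → .{{_ : NonZero n}} → .{{_ : NonZero k}} →
    (D : Digraph n) → Acyclic D →
    Decides (DMLOB D k) From (input D k) Within (c * k ^ (c * k) * n ^ c) By p)
-- Eight times the size provides for the factor 8 of the case `k = 1`; the additional 3 provides for
-- the exponents `3 * k` of 2 and 2 of `n`.
corollary1 = decideLeaves , 3 + 8 * size decideLeaves , λ n k D acyclic →
  let runs {s} {t} d t≤ answer = decideLeaves-runs D acyclic in
  s , t , d ,
  ≤-trans t≤ (time-bound n k (size decideLeaves) _ (m≤n+m _ 3) (m≤m+n 3 (8 * size decideLeaves))) , answer
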